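{- Let $M_n$ denote the space of complex $n\times n$ matrices, included in the space $M_{n+1}$ of complex $(n+1)\times(n+1)$ matrices as the upper-left $n\times n$ block (all other entries zero). Let $\tau\in M_{n+1}$ be such that no eigenvalue of $\tau$ is also an eigenvalue of the upper-left $n\times n$ submatrix $\tau_H$ of $\tau$. Let $x\in M_{n+1}$ with $[x,\tau]=0$, where $[a,b]=ab-ba$. Let $z=\mathrm{diag}(1,\dots,1,0)\in M_{n+1}$ (with $n$ ones). Suppose that $[x,[z,\tau]]=[y,\tau]$ for some $y\in M_n$. Then $x$ is a scalar matrix. -}

module Defs where

open import Level using (Level; _⊔_) renaming (suc to lsuc)
open import Algebra.Bundles using (CommutativeRing)
open import Data.Nat using (ℕ; zero; suc)
open import Data.Fin using (Fin; zero; suc; inject₁; _≟_)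
open import Data.Maybe using (Maybe; just; nothing)
import Data.Maybe as Maybe
open import Data.Product using (Σ; ∃; _×_)
open import Relation.Nullary using (¬_; yes; no)

module RingHelpers {c ℓ} (R : CommutativeRing c ℓ) where
  open CommutativeRing R using (Carrier; _+_; _*_; 0#; 1#)
  fromℕ : ℕ → Carrier
  fromℕ zero = 0#
  fromℕ (suc k) = 1# + fromℕ k
  -- monic polynomial x^(d+1) + Σ_{i ≤ d} a_i x^i, evaluated at t (Horner form)
  evalMonic : ∀ {d} → (Fin (suc d) → Carrier) → Carrier → Carrier
  evalMonic {d} a t = go d a
    where
    go : ∀ k → (Fin (suc k) → Carrier) → Carrier
    go zero b = b zero + t
    go (suc k) b = b zero + t * go k (λ i → b (suc i))

-- An algebraically closed field of characteristic zero (stands in for ℂ).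
record ACField (c ℓ : Level) : Set (lsuc (c ⊔ ℓ)) where
  field
    commRing : CommutativeRing c ℓ
  open CommutativeRing commRing public hiding (zero)
  open RingHelpers commRing public
  field
    1≉0 : ¬ (1# ≈ 0#)
    inverse : ∀ x → ¬ (x ≈ 0#) → Σ Carrier λ y → x * y ≈ 1#
    char0 : ∀ k → ¬ (fromℕ (suc k) ≈ 0#)
    algClosed : ∀ d (a : Fin (suc d) → Carrier) → Σ Carrier λ t → evalMonic a t ≈ 0#

module Matrices {c ℓ} (K : ACField c ℓ) where
  open ACField K

  Mat : ℕ → Set c
  Mat m = Fin m → Fin m → Carrier

  Vect : ℕ → Set c
  Vect m = Fin m → Carrier

  sumF : ∀ {m} → (Fin m → Carrier) → Carrier
  sumF {zero} f = 0#
  sumF {suc m} f = f zero + sumF (λ i → f (suc i))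

  _·_ : ∀ {m} → Mat m → Mat m → Mat m
  (A · B) i j = sumF (λ k → A i k * B k j)

  _⊙_ : ∀ {m} → Mat m → Vect m → Vect m
  (A ⊙ v) i = sumF (λ k → A i k * v k)

  _⊖_ : ∀ {m} → Mat m → Mat m → Mat m
  (A ⊖ B) i j = A i j - B i j

  [_,_] : ∀ {m} → Mat m → Mat m → Mat m
  [ A , B ] = (A · B) ⊖ (B · A)

  _≈M_ : ∀ {m} → Mat m → Mat m → Set ℓ
  A ≈M B = ∀ i j → A i j ≈ B i j

  δ : ∀ {m} → Mat m
  δ i j with i ≟ j
  ... | yes _ = 1#
  ... | no _ = 0#

  scalarMat : ∀ {m} → Carrier → Mat m
  scalarMat a i j = a * δ i j

  IsScalar : ∀ {m} → Mat m → Set (c ⊔ ℓ)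
  IsScalar {m} A = Σ Carrier λ a → A ≈M scalarMat a

  IsEigenvalue : ∀ {m} → Mat m → Carrier → Set (c ⊔ ℓ)
  IsEigenvalue {m} A λ' =
    Σ (Vect m) λ v → (∃ λ i → ¬ (v i ≈ 0#)) × (∀ i → (A ⊙ v) i ≈ λ' * v i)

  unlast : ∀ {n} → Fin (suc n) → Maybe (Fin n)
  unlast {zero} zero = nothing
  unlast {suc n} zero = just zero
  unlast {suc n} (suc i) = Maybe.map suc (unlast i)

  ι : ∀ {n} → Mat n → Mat (suc n)
  ι y i j with unlast i | unlast j
  ... | just i' | just j' = y i' j'
  ... | _ | _ = 0#

  upperLeft : ∀ {n} → Mat (suc n) → Mat n
  upperLeft τ i j = τ (inject₁ i) (inject₁ j)

  zMat : ∀ {n} → Mat (suc n)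
  zMat = ι δ

{-# OPTIONS --safe #-}

-- Since [x, τ] = 0, the Jacobi identity turns the hypothesis into [w, τ] = 0 for w = [x, z] - y.
-- With d the last diagonal entry of x, the matrix w + (x - d) has zero last column and
-- w - (x - d) has zero last row, and both commute with τ. Hence the first n columns of the former
-- and the first n rows of the latter intertwine τ with its upper-left block. As the two spectra
-- are disjoint, such intertwiners (solutions of a homogeneous Sylvester equation) vanish,
-- so 2 (x - d) = 0.
--
-- Equality in the field is neither decidable nor ¬¬-stable. Spectral arguments therefore only
-- show that the Sylvester operator has ¬¬-trivial kernel. This makes its determinant nonzero,
-- hence invertible, and Cramer's rule then gives a kernel that is trivial outright.
module Submission where

open import Defs
open import Algebra.Bundles using (CommutativeRing; RawRing)
open import Data.Bool using (true; false)
open import Data.Empty using (⊥-elim)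
open import Data.Fin using (Fin; zero; suc; _≟_; combine; remQuot; fromℕ; inject₁)
open import Data.Fin.Properties using (combine-remQuot; remQuot-combine; fromℕ≢inject₁; inject₁-injective)
open import Data.Fin.Relation.Unary.Top using (view; ‵fromℕ; ‵inject₁)
open import Data.Fin.Subset using (Subset; ∣_∣; ⊤)
open import Data.Fin.Subset.Properties using (∣p∣≤n; ∣p∣≡n⇒p≡⊤)
open import Data.Integer as ℤ using (ℤ; +_; -[1+_]; _⊖_)
import Data.Integer.Properties as ℤ
open import Data.List using (List; []; _∷_)
open import Data.List.Relation.Unary.All as All using (All; []; _∷_)
open import Data.Maybe as Maybe using (Maybe; just; nothing)
open import Data.Nat as ℕ using (ℕ; zero; suc; _<_)
import Data.Nat.Properties as ℕ
open import Data.Product using (Σ; ∃; _×_; _,_; proj₁; proj₂; uncurry)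
open import Data.Vec using ([]; _∷_)
open import Data.Vec.Functional using (tail) renaming (_∷_ to _◂_)
open import Function using (_∘_)
open import Level using (_⊔_)
open import Relation.Binary.PropositionalEquality as ≡ using (_≡_; _≢_)
open import Relation.Nullary using (¬_; yes; no)
open import Relation.Nullary.Negation using (¬¬-map)

-- The ring solver with integer coefficients.

module IntegerCoefficients {c ℓ} (R : CommutativeRing c ℓ) where
  open CommutativeRing R
  open import Algebra.Properties.Ring ring
  open import Algebra.Properties.AbelianGroup +-abelianGroup using (⁻¹-∙-comm; ε⁻¹≈ε; ⁻¹-involutive)
  open import Algebra.Properties.Semiring.Mult.TCOptimised semiring renaming (_×_ to _×′_)
  open import Algebra.Solver.Ring.AlmostCommutativeRing
  open import Relation.Binary.Reasoning.Setoid setoid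

  -- The solver has to recognise vanishing coefficients. Equality of integers is decidable, that of
  -- `R` need not be. With the optimised multiple `×′`, `con (+ 0)` and `con (+ 1)` evaluate to `0#`
  -- and `1#` definitionally, so solved equations match the goals as written.
  ⟦_⟧ : ℤ → Carrier
  ⟦ + n ⟧      = n ×′ 1#
  ⟦ -[1+ n ] ⟧ = - (suc n ×′ 1#)

  -‿homo : ∀ i → ⟦ ℤ.- i ⟧ ≈ - ⟦ i ⟧
  -‿homo (+ zero)    = sym ε⁻¹≈ε
  -‿homo (+ suc n)   = refl
  -‿homo -[1+ n ]    = sym (⁻¹-involutive _)

  ⊖-homo : ∀ m n → ⟦ m ⊖ n ⟧ ≈ m ×′ 1# - n ×′ 1#
  ⊖-homo m       zero    = sym (trans (+-congˡ ε⁻¹≈ε) (+-identityʳ _))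
  ⊖-homo zero    (suc n) = sym (+-identityˡ _)
  ⊖-homo (suc m) (suc n) = begin
    ⟦ suc m ⊖ suc n ⟧                      ≡⟨ ≡.cong ⟦_⟧ (ℤ.[1+m]⊖[1+n]≡m⊖n m n) ⟩
    ⟦ m ⊖ n ⟧                              ≈⟨ ⊖-homo m n ⟩
    m ×′ 1# - n ×′ 1#                        ≈⟨ +-congʳ (+-identityʳ _) ⟨
    m ×′ 1# + 0# - n ×′ 1#                   ≈⟨ +-congʳ (+-congˡ (-‿inverseʳ 1#)) ⟨
    m ×′ 1# + (1# - 1#) - n ×′ 1#            ≈⟨ +-congʳ (+-assoc _ _ _) ⟨
    m ×′ 1# + 1# - 1# - n ×′ 1#              ≈⟨ +-assoc _ _ _ ⟩
    m ×′ 1# + 1# + (- 1# - n ×′ 1#)          ≈⟨ +-cong (+-comm _ _) (⁻¹-∙-comm _ _) ⟩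
    1# + m ×′ 1# - (1# + n ×′ 1#)            ≈⟨ +-cong (1+× m 1#) (-‿cong (1+× n 1#)) ⟨
    suc m ×′ 1# - suc n ×′ 1#                ∎

  +-homo : ∀ i j → ⟦ i ℤ.+ j ⟧ ≈ ⟦ i ⟧ + ⟦ j ⟧
  +-homo (+ m)    (+ n)    = ×-homo-+ 1# m n
  +-homo (+ m)    -[1+ n ] = ⊖-homo m (suc n)
  +-homo -[1+ m ] (+ n)    = trans (⊖-homo n (suc m)) (+-comm _ _)
  +-homo -[1+ m ] -[1+ n ] = begin
    - (suc (suc (m ℕ.+ n)) ×′ 1#)           ≡⟨ ≡.cong (λ k → - (k ×′ 1#)) (≡.cong suc (≡.sym (ℕ.+-suc m n))) ⟩
    - ((suc m ℕ.+ suc n) ×′ 1#)             ≈⟨ -‿cong (×-homo-+ 1# (suc m) (suc n)) ⟩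
    - (suc m ×′ 1# + suc n ×′ 1#)            ≈⟨ ⁻¹-∙-comm _ _ ⟨
    - (suc m ×′ 1#) - suc n ×′ 1#            ∎

  +*-homo : ∀ m j → ⟦ + m ℤ.* j ⟧ ≈ m ×′ 1# * ⟦ j ⟧
  +*-homo m (+ n) = trans (reflexive (≡.cong ⟦_⟧ (≡.sym (ℤ.pos-* m n)))) (×1-homo-* m n)
  +*-homo m -[1+ n ] = begin
    ⟦ + m ℤ.* -[1+ n ] ⟧                   ≡⟨ ≡.cong ⟦_⟧ (ℤ.neg-distribʳ-* (+ m) (+ suc n)) ⟨
    ⟦ ℤ.- (+ m ℤ.* + suc n) ⟧              ≈⟨ -‿homo (+ m ℤ.* + suc n) ⟩
    - ⟦ + m ℤ.* + suc n ⟧                  ≈⟨ -‿cong (+*-homo m (+ suc n)) ⟩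
    - (m ×′ 1# * suc n ×′ 1#)                ≈⟨ -‿distribʳ-* _ _ ⟩
    m ×′ 1# * - (suc n ×′ 1#)                ∎

  *-homo : ∀ i j → ⟦ i ℤ.* j ⟧ ≈ ⟦ i ⟧ * ⟦ j ⟧
  *-homo (+ m)    j = +*-homo m j
  *-homo -[1+ m ] j = begin
    ⟦ -[1+ m ] ℤ.* j ⟧                     ≡⟨ ≡.cong ⟦_⟧ (ℤ.neg-distribˡ-* (+ suc m) j) ⟨
    ⟦ ℤ.- (+ suc m ℤ.* j) ⟧                ≈⟨ -‿homo (+ suc m ℤ.* j) ⟩
    - ⟦ + suc m ℤ.* j ⟧                    ≈⟨ -‿cong (+*-homo (suc m) j) ⟩
    - (suc m ×′ 1# * ⟦ j ⟧)                 ≈⟨ -‿distribˡ-* _ _ ⟩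
    - (suc m ×′ 1#) * ⟦ j ⟧                 ∎

  ℤ-rawRing : RawRing _ _
  ℤ-rawRing = CommutativeRing.rawRing ℤ.+-*-commutativeRing

  morphism : ℤ-rawRing -Raw-AlmostCommutative⟶ fromCommutativeRing R
  morphism = record
    { ⟦_⟧ = ⟦_⟧ ; +-homo = +-homo ; *-homo = *-homo ; -‿homo = -‿homo
    ; 0-homo = refl ; 1-homo = refl }

  -- Distinct integers may coincide in `R`, hence `nothing` rather than a refutation.
  _coeff≟_ : ∀ i j → Maybe (⟦ i ⟧ ≈ ⟦ j ⟧)
  i coeff≟ j with i ℤ.≟ j
  ... | yes i≡j = just (reflexive (≡.cong ⟦_⟧ i≡j))
  ... | no _    = nothing

  open import Algebra.Solver.Ring ℤ-rawRing (fromCommutativeRing R) morphism _coeff≟_ public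
    using (solve; _:=_; _:+_; _:*_; _:-_; :-_; con)

module LinearAlgebra {c ℓ} (K : ACField c ℓ) where
  open ACField K renaming (fromℕ to natural)
  open Matrices K
  open IntegerCoefficients commRing using (solve; _:=_; _:+_; _:*_; _:-_; :-_; con)
  open import Algebra.Properties.Group +-group using (x∙y⁻¹≈ε⇒x≈y)
  open import Relation.Binary.Reasoning.Setoid setoid

  -- Vectors, finite sums and the Kronecker delta.

  infix 4 _≈V_
  _≈V_ : ∀ {m} → Vect m → Vect m → Set ℓ
  v ≈V w = ∀ i → v i ≈ w i

  0V : ∀ {m} → Vect m
  0V _ = 0#

  -- The index type is arbitrary so that vectors and elements of the exterior algebra share one
  -- notion of linear combination. Scalar multiples and sums are brought into this form by padding
  -- with `0#` or `1#`.
  lin : ∀ {a} {A : Set a} → Carrier → (A → Carrier) → Carrier → (A → Carrier) → A → Carrier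
  lin a f b g x = a * f x + b * g x

  sumF-cong : ∀ {m} {f g : Vect m} → f ≈V g → sumF f ≈ sumF g
  sumF-cong {zero}  p = refl
  sumF-cong {suc m} p = +-cong (p zero) (sumF-cong (p ∘ suc))

  sumF-0 : ∀ {m} {f : Vect m} → f ≈V 0V → sumF f ≈ 0#
  sumF-0 {zero}  p = refl
  sumF-0 {suc m} p = trans (+-cong (p zero) (sumF-0 (p ∘ suc))) (+-identityʳ 0#)

  sumF-lin : ∀ {m} a (f : Vect m) b g → sumF (lin a f b g) ≈ a * sumF f + b * sumF g
  sumF-lin {zero}  a f b g = solve 2 (λ a b → con (+ 0) := a :* con (+ 0) :+ b :* con (+ 0)) refl a b
  sumF-lin {suc m} a f b g = trans (+-congˡ (sumF-lin a (f ∘ suc) b (g ∘ suc)))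
    (solve 6 (λ a b x y s t → a :* x :+ b :* y :+ (a :* s :+ b :* t) := a :* (x :+ s) :+ b :* (y :+ t))
      refl a b (f zero) (g zero) (sumF (f ∘ suc)) (sumF (g ∘ suc)))

  sumF-+ : ∀ {m} (f g : Vect m) → sumF (λ i → f i + g i) ≈ sumF f + sumF g
  sumF-+ {m} f g = begin
    sumF (λ i → f i + g i)          ≈⟨ sumF-cong {m} (λ i → sym (+-cong (*-identityˡ _) (*-identityˡ _))) ⟩
    sumF (lin 1# f 1# g)            ≈⟨ sumF-lin 1# f 1# g ⟩
    1# * sumF f + 1# * sumF g       ≈⟨ +-cong (*-identityˡ _) (*-identityˡ _) ⟩
    sumF f + sumF g                 ∎

  sumF-*ˡ : ∀ {m} a (f : Vect m) → sumF (λ i → a * f i) ≈ a * sumF f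
  sumF-*ˡ {zero}  a f = sym (zeroʳ a)
  sumF-*ˡ {suc m} a f = trans (+-congˡ (sumF-*ˡ a (f ∘ suc))) (sym (distribˡ a _ _))

  sumF-swap : ∀ {m n} (f : Fin m → Fin n → Carrier) →
    sumF (λ i → sumF (f i)) ≈ sumF (λ j → sumF (λ i → f i j))
  sumF-swap {zero} {n} f = sym (sumF-0 {n} (λ _ → refl))
  sumF-swap {suc m} f = trans (+-congˡ (sumF-swap (f ∘ suc)))
    (sym (sumF-+ (f zero) (λ j → sumF (λ i → f (suc i) j))))

  δ-refl : ∀ {m} (i : Fin m) → δ i i ≈ 1#
  δ-refl i with i ≟ i
  ... | yes _  = refl
  ... | no i≢i = ⊥-elim (i≢i ≡.refl)

  δ-suc : ∀ {m} (i j : Fin m) → δ (suc i) (suc j) ≈ δ i j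
  δ-suc i j with i ≟ j
  ... | yes _ = refl
  ... | no _  = refl

  sumF-δ : ∀ {m} (i : Fin m) (f : Vect m) → sumF (λ j → δ i j * f j) ≈ f i
  sumF-δ zero f = trans (+-cong (*-identityˡ _) (sumF-0 (λ j → zeroˡ (f (suc j))))) (+-identityʳ _)
  sumF-δ (suc i) f = begin
    0# * f zero + sumF (λ j → δ (suc i) (suc j) * f (suc j))
      ≈⟨ +-cong (zeroˡ _) (sumF-cong (λ j → *-congʳ (δ-suc i j))) ⟩
    0# + sumF (λ j → δ i j * f (suc j))  ≈⟨ +-identityˡ _ ⟩
    sumF (λ j → δ i j * f (suc j))       ≈⟨ sumF-δ i (f ∘ suc) ⟩
    f (suc i)                            ∎

  -- The exterior algebra

  -- The value at s is the coefficient of the product of the basis vectors indexed by s.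
  Ext : ℕ → Set c
  Ext n = Subset n → Carrier

  infix 4 _≈E_
  _≈E_ : ∀ {n} → Ext n → Ext n → Set ℓ
  ω ≈E η = ∀ s → ω s ≈ η s

  0E : ∀ {n} → Ext n
  0E _ = 0#

  1E : ∀ {n} → Ext n
  1E []          = 1#
  1E (false ∷ s) = 1E s
  1E (true ∷ s)  = 0#

  infixr 7 _∧_ _⌟_

  -- Writing ω = ω₀ + e₀ ∧ ω₁ and v = v₀ e₀ + v', one has v ∧ ω = v' ∧ ω₀ + e₀ ∧ (v₀ ω₀ - v' ∧ ω₁).
  _∧_ : ∀ {n} → Vect n → Ext n → Ext n
  (v ∧ ω) []          = 0#
  (v ∧ ω) (false ∷ s) = (tail v ∧ (ω ∘ (false ∷_))) s
  (v ∧ ω) (true ∷ s)  = lin (v zero) (ω ∘ (false ∷_)) (- 1#) (tail v ∧ (ω ∘ (true ∷_))) s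

  -- Contraction with a covector. Writing ω = ω₀ + e₀ ∧ ω₁ and splitting φ into φ₀ and φ', it is φ₀
  -- ω₁ + φ' ⌟ ω₀ - e₀ ∧ (φ' ⌟ ω₁).
  _⌟_ : ∀ {n} → Vect n → Ext n → Ext n
  (φ ⌟ ω) []          = 0#
  (φ ⌟ ω) (false ∷ s) = lin (φ zero) (ω ∘ (true ∷_)) 1# (tail φ ⌟ (ω ∘ (false ∷_))) s
  (φ ⌟ ω) (true ∷ s)  = - 1# * (tail φ ⌟ (ω ∘ (true ∷_))) s

  ∧-cong : ∀ {n} {u v : Vect n} {ω η : Ext n} → u ≈V v → ω ≈E η → u ∧ ω ≈E v ∧ η
  ∧-cong p q []          = refl
  ∧-cong p q (false ∷ s) = ∧-cong (p ∘ suc) (q ∘ (false ∷_)) s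
  ∧-cong p q (true ∷ s)  = +-cong (*-cong (p zero) (q (false ∷ s)))
                             (*-congˡ (∧-cong (p ∘ suc) (q ∘ (true ∷_)) s))

  ∧-congʳ : ∀ {n} (u : Vect n) {ω η : Ext n} → ω ≈E η → u ∧ ω ≈E u ∧ η
  ∧-congʳ u = ∧-cong (λ _ → refl)

  ∧-linʳ : ∀ {n} (v : Vect n) a ω b η → v ∧ lin a ω b η ≈E lin a (v ∧ ω) b (v ∧ η)
  ∧-linʳ v a ω b η [] = solve 2 (λ a b → con (+ 0) := a :* con (+ 0) :+ b :* con (+ 0)) refl a b
  ∧-linʳ v a ω b η (false ∷ s) = ∧-linʳ (tail v) a _ b _ s
  ∧-linʳ v a ω b η (true ∷ s) = trans (+-congˡ (*-congˡ (∧-linʳ (tail v) a _ b _ s)))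
    (solve 7 (λ v a b x y s t →
        v :* (a :* x :+ b :* y) :+ :- con (+ 1) :* (a :* s :+ b :* t)
      := a :* (v :* x :+ :- con (+ 1) :* s) :+ b :* (v :* y :+ :- con (+ 1) :* t))
      refl (v zero) a b (ω (false ∷ s)) (η (false ∷ s)) _ _)

  ∧-linˡ : ∀ {n} a (u : Vect n) b v ω → lin a u b v ∧ ω ≈E lin a (u ∧ ω) b (v ∧ ω)
  ∧-linˡ a u b v ω [] = solve 2 (λ a b → con (+ 0) := a :* con (+ 0) :+ b :* con (+ 0)) refl a b
  ∧-linˡ a u b v ω (false ∷ s) = ∧-linˡ a (tail u) b (tail v) _ s
  ∧-linˡ a u b v ω (true ∷ s) = trans (+-congˡ (*-congˡ (∧-linˡ a (tail u) b (tail v) _ s)))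
    (solve 7 (λ u v a b x s t →
        (a :* u :+ b :* v) :* x :+ :- con (+ 1) :* (a :* s :+ b :* t)
      := a :* (u :* x :+ :- con (+ 1) :* s) :+ b :* (v :* x :+ :- con (+ 1) :* t))
      refl (u zero) (v zero) a b (ω (false ∷ s)) _ _)

  ∧-zeroʳ : ∀ {n} (v : Vect n) {ω} → ω ≈E 0E → v ∧ ω ≈E 0E
  ∧-zeroʳ v p []          = refl
  ∧-zeroʳ v p (false ∷ s) = ∧-zeroʳ (tail v) (p ∘ (false ∷_)) s
  ∧-zeroʳ v p (true ∷ s)  = trans (+-cong (*-congˡ (p (false ∷ s))) (*-congˡ (∧-zeroʳ (tail v) (p ∘ (true ∷_)) s)))
    (solve 1 (λ a → a :* con (+ 0) :+ :- con (+ 1) :* con (+ 0) := con (+ 0)) refl (v zero))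

  ∧-zeroˡ : ∀ {n} {v : Vect n} ω → v ≈V 0V → v ∧ ω ≈E 0E
  ∧-zeroˡ ω p []          = refl
  ∧-zeroˡ ω p (false ∷ s) = ∧-zeroˡ _ (p ∘ suc) s
  ∧-zeroˡ ω p (true ∷ s)  = trans (+-cong (*-congʳ (p zero)) (*-congˡ (∧-zeroˡ _ (p ∘ suc) s)))
    (solve 1 (λ a → con (+ 0) :* a :+ :- con (+ 1) :* con (+ 0) := con (+ 0)) refl (ω (false ∷ s)))

  -- Only left multiplication by vectors is defined, so the relations of the exterior algebra are
  -- stated as identities between operators on `Ext n`.
  ∧-square : ∀ {n} (v : Vect n) ω → v ∧ v ∧ ω ≈E 0E
  ∧-square v ω []          = refl
  ∧-square v ω (false ∷ s) = ∧-square (tail v) _ s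
  ∧-square v ω (true ∷ s)  = begin
    v zero * x + - 1# * (tail v ∧ lin (v zero) (ω ∘ (false ∷_)) (- 1#) (tail v ∧ (ω ∘ (true ∷_)))) s
      ≈⟨ +-congˡ (*-congˡ (trans (∧-linʳ (tail v) _ _ _ _ s) (+-congˡ (*-congˡ (∧-square (tail v) _ s))))) ⟩
    v zero * x + - 1# * (v zero * x + - 1# * 0#)
      ≈⟨ solve 2 (λ v x → v :* x :+ :- con (+ 1) :* (v :* x :+ :- con (+ 1) :* con (+ 0)) := con (+ 0))
           refl (v zero) x ⟩
    0# ∎
    where x = (tail v ∧ (ω ∘ (false ∷_))) s

  ∧-anticomm : ∀ {n} (u v : Vect n) ω → u ∧ v ∧ ω ≈E λ s → - (v ∧ u ∧ ω) s
  ∧-anticomm u v ω [] = solve 0 (con (+ 0) := :- con (+ 0)) refl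
  ∧-anticomm u v ω (false ∷ s) = ∧-anticomm (tail u) (tail v) _ s
  ∧-anticomm u v ω (true ∷ s) = begin
    u zero * x + - 1# * (tail u ∧ lin (v zero) (ω ∘ (false ∷_)) (- 1#) (tail v ∧ (ω ∘ (true ∷_)))) s
      ≈⟨ +-congˡ (*-congˡ (trans (∧-linʳ (tail u) _ _ _ _ s)
                                 (+-congˡ (*-congˡ (∧-anticomm (tail u) (tail v) _ s))))) ⟩
    u zero * x + - 1# * (v zero * y + - 1# * - z)
      ≈⟨ solve 5 (λ u v x y z → u :* x :+ :- con (+ 1) :* (v :* y :+ :- con (+ 1) :* :- z)
             := :- (v :* y :+ :- con (+ 1) :* (u :* x :+ :- con (+ 1) :* z)))
           refl (u zero) (v zero) x y z ⟩
    - (v zero * y + - 1# * (u zero * x + - 1# * z))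
      ≈⟨ -‿cong (+-congˡ (*-congˡ (∧-linʳ (tail v) _ _ _ _ s))) ⟨
    - (v zero * y + - 1# * (tail v ∧ lin (u zero) (ω ∘ (false ∷_)) (- 1#) (tail u ∧ (ω ∘ (true ∷_)))) s) ∎
    where
    x = (tail v ∧ (ω ∘ (false ∷_))) s
    y = (tail u ∧ (ω ∘ (false ∷_))) s
    z = (tail v ∧ tail u ∧ (ω ∘ (true ∷_))) s

  ⌟-lin : ∀ {n} (φ : Vect n) a ω b η → φ ⌟ lin a ω b η ≈E lin a (φ ⌟ ω) b (φ ⌟ η)
  ⌟-lin φ a ω b η [] = solve 2 (λ a b → con (+ 0) := a :* con (+ 0) :+ b :* con (+ 0)) refl a b
  ⌟-lin φ a ω b η (false ∷ s) = trans (+-congˡ (*-congˡ (⌟-lin (tail φ) a _ b _ s)))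
    (solve 7 (λ v a b x y s t →
        v :* (a :* x :+ b :* y) :+ con (+ 1) :* (a :* s :+ b :* t)
      := a :* (v :* x :+ con (+ 1) :* s) :+ b :* (v :* y :+ con (+ 1) :* t))
      refl (φ zero) a b (ω (true ∷ s)) (η (true ∷ s)) _ _)
  ⌟-lin φ a ω b η (true ∷ s) = trans (*-congˡ (⌟-lin (tail φ) a _ b _ s))
    (solve 4 (λ a b s t → :- con (+ 1) :* (a :* s :+ b :* t)
      := a :* (:- con (+ 1) :* s) :+ b :* (:- con (+ 1) :* t)) refl a b _ _)

  ⌟-zero : ∀ {n} (φ : Vect n) {ω} → ω ≈E 0E → φ ⌟ ω ≈E 0E
  ⌟-zero φ p []          = refl
  ⌟-zero φ p (false ∷ s) = trans (+-cong (*-congˡ (p (true ∷ s))) (*-congˡ (⌟-zero (tail φ) (p ∘ (false ∷_)) s)))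
    (solve 1 (λ a → a :* con (+ 0) :+ con (+ 1) :* con (+ 0) := con (+ 0)) refl (φ zero))
  ⌟-zero φ p (true ∷ s)  = trans (*-congˡ (⌟-zero (tail φ) (p ∘ (true ∷_)) s)) (zeroʳ _)

  ⌟-1E : ∀ {n} (φ : Vect n) → φ ⌟ 1E ≈E 0E
  ⌟-1E φ []          = refl
  ⌟-1E φ (false ∷ s) = trans (+-congˡ (*-congˡ (⌟-1E (tail φ) s)))
    (solve 1 (λ a → a :* con (+ 0) :+ con (+ 1) :* con (+ 0) := con (+ 0)) refl (φ zero))
  ⌟-1E φ (true ∷ s)  = trans (*-congˡ (⌟-zero (tail φ) (λ _ → refl) s)) (zeroʳ _)

  ⟨_,_⟩ : ∀ {n} → Vect n → Vect n → Carrier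
  ⟨ φ , v ⟩ = sumF (λ i → φ i * v i)

  -- The graded Leibniz rule. It lets a contraction pass the vectors that `φ` kills and evaluate on
  -- the one that it does not.
  ⌟-∧ : ∀ {n} (φ v : Vect n) ω s → (φ ⌟ v ∧ ω) s ≈ ⟨ φ , v ⟩ * ω s - (v ∧ φ ⌟ ω) s
  ⌟-∧ φ v ω [] = solve 1 (λ x → con (+ 0) := con (+ 0) :* x :- con (+ 0)) refl (ω [])
  ⌟-∧ φ v ω (false ∷ s) = begin
    φ zero * (v zero * x + - 1# * y) + 1# * (tail φ ⌟ tail v ∧ (ω ∘ (false ∷_))) s
      ≈⟨ +-congˡ (*-congˡ (⌟-∧ (tail φ) (tail v) _ s)) ⟩
    φ zero * (v zero * x + - 1# * y) + 1# * (p * x - z)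
      ≈⟨ solve 6 (λ f v x y z p → f :* (v :* x :+ :- con (+ 1) :* y) :+ con (+ 1) :* (p :* x :- z)
                   := (f :* v :+ p) :* x :- (f :* y :+ con (+ 1) :* z))
           refl (φ zero) (v zero) x y z p ⟩
    (φ zero * v zero + p) * x - (φ zero * y + 1# * z)
      ≈⟨ +-congˡ (-‿cong (∧-linʳ (tail v) _ _ _ _ s)) ⟨
    (φ zero * v zero + p) * x - (tail v ∧ lin (φ zero) (ω ∘ (true ∷_)) 1# (tail φ ⌟ (ω ∘ (false ∷_)))) s ∎
    where
    x = ω (false ∷ s)
    y = (tail v ∧ (ω ∘ (true ∷_))) s
    z = (tail v ∧ tail φ ⌟ (ω ∘ (false ∷_))) s
    p = ⟨ tail φ , tail v ⟩
  ⌟-∧ φ v ω (true ∷ s) = begin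
    - 1# * (tail φ ⌟ lin (v zero) (ω ∘ (false ∷_)) (- 1#) (tail v ∧ (ω ∘ (true ∷_)))) s
      ≈⟨ *-congˡ (trans (⌟-lin (tail φ) _ _ _ _ s) (+-congˡ (*-congˡ (⌟-∧ (tail φ) (tail v) _ s)))) ⟩
    - 1# * (v zero * y + - 1# * (p * x - z))
      -- The summand `0# * z` is padding that turns a scalar multiple into a `lin`, to which
      -- `∧-linʳ` applies.
      ≈⟨ solve 6 (λ f v x y z p → :- con (+ 1) :* (v :* y :+ :- con (+ 1) :* (p :* x :- z))
                   := (f :* v :+ p) :* x :- (v :* (f :* x :+ con (+ 1) :* y)
                        :+ :- con (+ 1) :* (:- con (+ 1) :* z :+ con (+ 0) :* z)))
           refl (φ zero) (v zero) x y z p ⟩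
    (φ zero * v zero + p) * x - (v zero * (φ zero * x + 1# * y) + - 1# * (- 1# * z + 0# * z))
      ≈⟨ +-congˡ (-‿cong (+-congˡ (*-congˡ (trans (∧-congʳ (tail v) (λ s → sym (trans (+-congˡ (zeroˡ _)) (+-identityʳ _))) s)
                                                     (∧-linʳ (tail v) _ _ _ _ s))))) ⟨
    (φ zero * v zero + p) * x - (v ∧ φ ⌟ ω) (true ∷ s) ∎
    where
    x = ω (true ∷ s)
    y = (tail φ ⌟ (ω ∘ (false ∷_))) s
    z = (tail v ∧ tail φ ⌟ (ω ∘ (true ∷_))) s
    p = ⟨ tail φ , tail v ⟩

  -- Cramer's rule and linear dependence

  -- The product is a_(k-1) ∧ ... ∧ a₀ ∧ ω, in reverse order, so that inductions on the family can
  -- absorb its head into `ω`. The order affects only a sign.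
  wedge : ∀ {k n} → (Fin k → Vect n) → Ext n → Ext n
  wedge {zero}  a ω = ω
  wedge {suc k} a ω = wedge (tail a) (a zero ∧ ω)

  wedge-cong : ∀ {k n} (a : Fin k → Vect n) {ω η} → ω ≈E η → wedge a ω ≈E wedge a η
  wedge-cong {zero}  a p = p
  wedge-cong {suc k} a p = wedge-cong (tail a) (∧-congʳ (a zero) p)

  wedge-lin : ∀ {k n} (a : Fin k → Vect n) x ω y η →
    wedge a (lin x ω y η) ≈E lin x (wedge a ω) y (wedge a η)
  wedge-lin {zero}  a x ω y η s = refl
  wedge-lin {suc k} a x ω y η s =
    trans (wedge-cong (tail a) (∧-linʳ (a zero) x ω y η) s) (wedge-lin (tail a) x _ y _ s)

  wedge-zero : ∀ {k n} (a : Fin k → Vect n) {ω} → ω ≈E 0E → wedge a ω ≈E 0E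
  wedge-zero {zero}  a p = p
  wedge-zero {suc k} a p = wedge-zero (tail a) (∧-zeroʳ (a zero) p)

  wedge-neg : ∀ {k n} (a : Fin k → Vect n) {ω} {η} →
    ω ≈E (λ s → - η s) → wedge a η ≈E 0E → wedge a ω ≈E 0E
  wedge-neg a {ω} {η} p q s = begin
    wedge a ω s                               ≈⟨ wedge-cong a (λ s → trans (p s) (neg (η s))) s ⟩
    wedge a (lin (- 1#) η 0# η) s             ≈⟨ wedge-lin a (- 1#) η 0# η s ⟩
    - 1# * wedge a η s + 0# * wedge a η s     ≈⟨ neg (wedge a η s) ⟨
    - wedge a η s                             ≈⟨ -‿cong (q s) ⟩
    - 0#                                      ≈⟨ solve 0 (:- con (+ 0) := con (+ 0)) refl ⟩
    0#                                        ∎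
    where
    neg : ∀ x → - x ≈ - 1# * x + 0# * x
    neg = solve 1 (λ x → :- x := :- con (+ 1) :* x :+ con (+ 0) :* x) refl

  -- The extra factor is moved by anticommutation past a₀, a₁, ... until it meets its own copy,
  -- where `∧-square` applies.
  wedge-repeated : ∀ {k n} (a : Fin k → Vect n) ω j → wedge a (a j ∧ ω) ≈E 0E
  wedge-repeated a ω zero    = wedge-zero (tail a) (∧-square (a zero) ω)
  wedge-repeated a ω (suc j) =
    wedge-neg (tail a) (∧-anticomm (a zero) (a (suc j)) ω) (wedge-repeated (tail a) (a zero ∧ ω) j)

  comb : ∀ {k n} → Vect k → (Fin k → Vect n) → Vect n
  comb v a i = sumF (λ j → v j * a j i)

  comb-∧ : ∀ {k n} (v : Vect (suc k)) (a : Fin (suc k) → Vect n) ω →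
    comb v a ∧ ω ≈E lin (v zero) (a zero ∧ ω) 1# (comb (tail v) (tail a) ∧ ω)
  comb-∧ v a ω s = trans (∧-cong (λ i → +-congˡ (sym (*-identityˡ _))) (λ _ → refl) s)
                         (∧-linˡ (v zero) (a zero) 1# (comb (tail v) (tail a)) ω s)

  -- The families `b` and `a` are kept apart because the induction shortens only the combination.
  wedge-comb : ∀ {l k n} (b : Fin l → Vect n) (v : Vect k) (a : Fin k → Vect n) ω →
    (∀ j → wedge b (a j ∧ ω) ≈E 0E) → wedge b (comb v a ∧ ω) ≈E 0E
  wedge-comb {k = zero}  b v a ω p = wedge-zero b (∧-zeroˡ ω (λ _ → refl))
  wedge-comb {k = suc k} b v a ω p s = begin
    wedge b (comb v a ∧ ω) s
      ≈⟨ wedge-cong b (comb-∧ v a ω) s ⟩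
    wedge b (lin (v zero) (a zero ∧ ω) 1# (comb (tail v) (tail a) ∧ ω)) s
      ≈⟨ wedge-lin b _ _ _ _ s ⟩
    v zero * wedge b (a zero ∧ ω) s + 1# * wedge b (comb (tail v) (tail a) ∧ ω) s
      ≈⟨ +-cong (*-congˡ (p zero s)) (*-congˡ (wedge-comb b (tail v) (tail a) ω (p ∘ suc) s)) ⟩
    v zero * 0# + 1# * 0#
      ≈⟨ solve 1 (λ x → x :* con (+ 0) :+ con (+ 1) :* con (+ 0) := con (+ 0)) refl (v zero) ⟩
    0# ∎

  -- If the factor a_j of the product is replaced by the whole combination, every other term repeats
  -- a vector and only v_j times the product survives. The hypothesis is weakened from a vanishing
  -- combination to one annihilating `ω`, which is what persists when a₀ is absorbed into `ω`.
  cramer : ∀ {k n} (v : Vect k) (a : Fin k → Vect n) ω →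
    comb v a ∧ ω ≈E 0E → ∀ j s → v j * wedge a ω s ≈ 0#
  cramer v a ω p zero s = begin
    v zero * wedge (tail a) (a zero ∧ ω) s
      ≈⟨ solve 2 (λ x y → x :* y := x :* y :+ con (+ 1) :* con (+ 0)) refl (v zero) _ ⟩
    v zero * wedge (tail a) (a zero ∧ ω) s + 1# * 0#
      ≈⟨ +-congˡ (*-congˡ (wedge-comb (tail a) (tail v) (tail a) ω (wedge-repeated (tail a) ω) s)) ⟨
    v zero * wedge (tail a) (a zero ∧ ω) s + 1# * wedge (tail a) (comb (tail v) (tail a) ∧ ω) s
      ≈⟨ wedge-lin (tail a) _ _ _ _ s ⟨
    wedge (tail a) (lin (v zero) (a zero ∧ ω) 1# (comb (tail v) (tail a) ∧ ω)) s
      ≈⟨ wedge-zero (tail a) (λ s → trans (sym (comb-∧ v a ω s)) (p s)) s ⟩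
    0# ∎
  cramer v a ω p (suc j) = cramer (tail v) (tail a) (a zero ∧ ω) q j
    where
    w = comb (tail v) (tail a)
    q : w ∧ a zero ∧ ω ≈E 0E
    q s = begin
      (w ∧ a zero ∧ ω) s
        ≈⟨ ∧-anticomm w (a zero) ω s ⟩
      - (a zero ∧ w ∧ ω) s
        -- As a₀ ∧ a₀ ∧ ω vanishes, the missing term v₀ a₀ may be inserted to complete the tail to
        -- the full combination.
        ≈⟨ solve 2 (λ x y → :- y := :- (x :* con (+ 0) :+ con (+ 1) :* y)) refl (v zero) _ ⟩
      - (v zero * 0# + 1# * (a zero ∧ w ∧ ω) s)
        ≈⟨ -‿cong (+-congʳ (*-congˡ (∧-square (a zero) ω s))) ⟨
      - (v zero * (a zero ∧ a zero ∧ ω) s + 1# * (a zero ∧ w ∧ ω) s)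
        ≈⟨ -‿cong (∧-linʳ (a zero) _ _ _ _ s) ⟨
      - (a zero ∧ lin (v zero) (a zero ∧ ω) 1# (w ∧ ω)) s
        ≈⟨ -‿cong (∧-zeroʳ (a zero) (λ s → trans (sym (comb-∧ v a ω s)) (p s)) s) ⟩
      - 0#
        ≈⟨ solve 0 (:- con (+ 0) := con (+ 0)) refl ⟩
      0# ∎

  -- The row operations of elimination: the subtracted multiples of `a` die against `ω`. In the use
  -- below `ω` has `a` as a factor, and by anticommutation the hypothesis survives further factors.
  wedge-reduce : ∀ {k n} (a : Vect n) (d : Vect k) (b : Fin k → Vect n) ω → a ∧ ω ≈E 0E →
    wedge (λ j → lin 1# (b j) (- d j) a) ω ≈E wedge b ω
  wedge-reduce {zero}  a d b ω p s = refl
  wedge-reduce {suc k} a d b ω p s = begin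
    wedge (λ j → lin 1# (b (suc j)) (- d (suc j)) a) (lin 1# (b zero) (- d zero) a ∧ ω) s
      ≈⟨ wedge-cong (λ j → lin 1# (b (suc j)) (- d (suc j)) a) b₀∧ω s ⟩
    wedge (λ j → lin 1# (b (suc j)) (- d (suc j)) a) (b zero ∧ ω) s
      ≈⟨ wedge-reduce a (tail d) (tail b) (b zero ∧ ω) q s ⟩
    wedge (tail b) (b zero ∧ ω) s ∎
    where
    b₀∧ω : lin 1# (b zero) (- d zero) a ∧ ω ≈E b zero ∧ ω
    b₀∧ω s = trans (∧-linˡ 1# (b zero) (- d zero) a ω s) (trans (+-congˡ (*-congˡ (p s)))
      (solve 2 (λ x y → con (+ 1) :* x :+ y :* con (+ 0) := x) refl _ (- d zero)))
    q : a ∧ b zero ∧ ω ≈E 0E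
    q s = trans (∧-anticomm a (b zero) ω s)
      (trans (-‿cong (∧-zeroʳ (b zero) p s)) (solve 0 (:- con (+ 0) := con (+ 0)) refl))

  -- Contraction with `φ` anticommutes with each b_j, so up to sign the right-hand product is the
  -- contraction of the left-hand one.
  wedge-⌟ : ∀ {k n} (φ : Vect n) (b : Fin k → Vect n) ω → (∀ j → ⟨ φ , b j ⟩ ≈ 0#) →
    wedge b ω ≈E 0E → wedge b (φ ⌟ ω) ≈E 0E
  wedge-⌟ {zero}  φ b ω p q = ⌟-zero φ q
  wedge-⌟ {suc k} φ b ω p q = wedge-neg (tail b) r (wedge-⌟ φ (tail b) (b zero ∧ ω) (p ∘ suc) q)
    where
    r : b zero ∧ φ ⌟ ω ≈E λ s → - (φ ⌟ b zero ∧ ω) s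
    r s = begin
      (b zero ∧ φ ⌟ ω) s
        ≈⟨ solve 2 (λ x y → x := :- (con (+ 0) :* y :- x)) refl _ (ω s) ⟩
      - (0# * ω s - (b zero ∧ φ ⌟ ω) s)
        ≈⟨ -‿cong (+-congʳ (*-congʳ (p zero))) ⟨
      - (⟨ φ , b zero ⟩ * ω s - (b zero ∧ φ ⌟ ω) s)
        ≈⟨ -‿cong (⌟-∧ φ (b zero) ω s) ⟨
      - (φ ⌟ b zero ∧ ω) s ∎

  1E≉0E : ∀ n → ¬ (1E {n} ≈E 0E)
  1E≉0E zero    p = 1≉0 (p [])
  1E≉0E (suc n) p = 1E≉0E n (p ∘ (false ∷_))

  -- Since the index set is finite, the double negations can be discharged one index at a time.
  ¬¬-∀ : ∀ {p n} {P : Fin n → Set p} → (∀ i → ¬ ¬ P i) → ¬ ¬ (∀ i → P i)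
  ¬¬-∀ {n = zero}  h k = k λ ()
  ¬¬-∀ {n = suc n} h k = h zero λ p₀ → ¬¬-∀ (h ∘ suc) λ ps → k λ { zero → p₀ ; (suc i) → ps i }

  -- This replaces a case distinction on whether a vector is zero: a proof of a contradiction may
  -- treat separately the case of a nonzero entry and that of the zero vector.
  vanish : ∀ {m} {v : Vect m} → ¬ (∃ λ i → ¬ v i ≈ 0#) → ¬ ¬ (v ≈V 0V)
  vanish ¬∃ = ¬¬-∀ (λ i vᵢ≉0 → ¬∃ (i , vᵢ≉0))

  Dependent : ∀ {k n} → (Fin k → Vect n) → Set (c ⊔ ℓ)
  Dependent {k} a = Σ (Vect k) λ v → (∃ λ j → ¬ v j ≈ 0#) × comb v a ≈V 0V

  -- Gaussian elimination: with a pivot (a₀)ᵢ the i-th coordinate of the other vectors is cleared,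
  -- and contraction with that coordinate then removes a₀ from the product.
  wedge≈0⇒dependent : ∀ {k n} (a : Fin k → Vect n) → wedge a 1E ≈E 0E → ¬ ¬ Dependent a
  wedge≈0⇒dependent {zero}  {n} a p ¬dep = 1E≉0E n p
  wedge≈0⇒dependent {suc k} {n} a p ¬dep = vanish a₀≉0⇒⊥ a₀≈0⇒⊥
    where
    b = tail a

    a₀≈0⇒⊥ : ¬ (a zero ≈V 0V)
    a₀≈0⇒⊥ a₀≈0 = ¬dep (1# ◂ 0V , (zero , 1≉0) , λ i →
      trans (+-cong (trans (*-identityˡ _) (a₀≈0 i)) (sumF-0 {k} (λ j → zeroˡ _))) (+-identityʳ 0#))

    a₀≉0⇒⊥ : ¬ (∃ λ i → ¬ a zero i ≈ 0#)
    a₀≉0⇒⊥ (i , a₀ᵢ≉0) = wedge≈0⇒dependent b' b'≈0 ¬dep'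
      where
      q = proj₁ (inverse _ a₀ᵢ≉0)
      a₀ᵢq≈1 = proj₂ (inverse _ a₀ᵢ≉0)
      d : Vect k
      d j = b j i * q
      b' : Fin k → Vect n
      b' j = lin 1# (b j) (- d j) (a zero)

      b'ᵢ≈0 : ∀ j → ⟨ δ i , b' j ⟩ ≈ 0#
      b'ᵢ≈0 j = begin
        ⟨ δ i , b' j ⟩                    ≈⟨ sumF-δ i (b' j) ⟩
        1# * b j i + - (b j i * q) * a zero i
          ≈⟨ solve 3 (λ x q y → con (+ 1) :* x :+ :- (x :* q) :* y := x :- x :* (y :* q)) refl (b j i) q (a zero i) ⟩
        b j i - b j i * (a zero i * q)        ≈⟨ +-congˡ (-‿cong (*-congˡ a₀ᵢq≈1)) ⟩
        b j i - b j i * 1#                    ≈⟨ solve 1 (λ x → x :- x :* con (+ 1) := con (+ 0)) refl (b j i) ⟩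
        0#                                    ∎

      contracted : δ i ⌟ a zero ∧ 1E ≈E lin (a zero i) 1E 0# 1E
      contracted s = begin
        (δ i ⌟ a zero ∧ 1E) s
          ≈⟨ ⌟-∧ (δ i) (a zero) 1E s ⟩
        ⟨ δ i , a zero ⟩ * 1E s - (a zero ∧ δ i ⌟ 1E) s
          ≈⟨ +-cong (*-congʳ (sumF-δ i (a zero))) (-‿cong (∧-zeroʳ (a zero) (⌟-1E (δ i)) s)) ⟩
        a zero i * 1E s - 0#
          ≈⟨ solve 2 (λ x y → x :* y :- con (+ 0) := x :* y :+ con (+ 0) :* y) refl (a zero i) (1E s) ⟩
        a zero i * 1E s + 0# * 1E s ∎

      b'≈0 : wedge b' 1E ≈E 0E
      b'≈0 s = begin
        w                                     ≈⟨ *-identityˡ w ⟨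
        1# * w                                ≈⟨ *-congʳ a₀ᵢq≈1 ⟨
        a zero i * q * w
          ≈⟨ solve 3 (λ x q w → x :* q :* w := q :* (x :* w :+ con (+ 0) :* w)) refl (a zero i) q w ⟩
        q * (a zero i * w + 0# * w)
          ≈⟨ *-congˡ (wedge-lin b' (a zero i) 1E 0# 1E s) ⟨
        q * wedge b' (lin (a zero i) 1E 0# 1E) s
          ≈⟨ *-congˡ (wedge-cong b' contracted s) ⟨
        q * wedge b' (δ i ⌟ a zero ∧ 1E) s
          ≈⟨ *-congˡ (wedge-⌟ (δ i) b' (a zero ∧ 1E) b'ᵢ≈0 (λ s →
               trans (wedge-reduce (a zero) d b (a zero ∧ 1E) (∧-square (a zero) 1E) s) (p s)) s) ⟩
        q * 0#                                ≈⟨ zeroʳ q ⟩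
        0#                                    ∎
        where w = wedge b' 1E s

      ¬dep' : ¬ Dependent b'
      -- A relation among the reduced vectors b_j - d_j a₀ is one among the b_j and a₀ in which a₀
      -- has the coefficient -(Σ v_j d_j).
      ¬dep' (v , (j , vⱼ≉0) , vb'≈0) = ¬dep (- e ◂ v , (suc j , vⱼ≉0) , λ i' → begin
        - e * a zero i' + comb v b i'
          ≈⟨ solve 3 (λ e x y → :- e :* x :+ y := con (+ 1) :* y :+ :- x :* e) refl e (a zero i') _ ⟩
        1# * comb v b i' + - a zero i' * e
          ≈⟨ sumF-lin {k} 1# _ (- a zero i') _ ⟨
        sumF (λ j → 1# * (v j * b j i') + - a zero i' * (v j * d j))
          ≈⟨ sumF-cong {k} (λ j → solve 4 (λ v b x d → con (+ 1) :* (v :* b) :+ :- x :* (v :* d)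
                                     := v :* (con (+ 1) :* b :+ :- d :* x)) refl (v j) (b j i') (a zero i') (d j)) ⟩
        comb v b' i'
          ≈⟨ vb'≈0 i' ⟩
        0# ∎)
        where e = sumF (λ j → v j * d j)

  -- The offset m absorbs the basis vectors split off by the recursion on s.
  ∧-degree : ∀ {n} m k (v : Vect n) ω → (∀ s → m ℕ.+ ∣ s ∣ ≢ k → ω s ≈ 0#) →
    ∀ s → m ℕ.+ ∣ s ∣ ≢ suc k → (v ∧ ω) s ≈ 0#
  ∧-degree m k v ω p []          q = refl
  ∧-degree m k v ω p (false ∷ s) q = ∧-degree m k (tail v) (ω ∘ (false ∷_)) (p ∘ (false ∷_)) s q
  ∧-degree m k v ω p (true ∷ s)  q = trans
    (+-cong (*-congˡ (p (false ∷ s) (λ e → q' (≡.cong suc e))))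
            (*-congˡ (∧-degree (suc m) k (tail v) (ω ∘ (true ∷_))
              (λ s e → p (true ∷ s) (e ∘ ≡.trans (≡.sym (ℕ.+-suc m ∣ s ∣)))) s q')))
    (solve 1 (λ a → a :* con (+ 0) :+ :- con (+ 1) :* con (+ 0) := con (+ 0)) refl (v zero))
    where
    q' : suc m ℕ.+ ∣ s ∣ ≢ suc k
    q' = q ∘ ≡.trans (ℕ.+-suc m ∣ s ∣)

  wedge-degree : ∀ {k n} (a : Fin k → Vect n) m ω → (∀ s → ∣ s ∣ ≢ m → ω s ≈ 0#) →
    ∀ s → ∣ s ∣ ≢ k ℕ.+ m → wedge a ω s ≈ 0#
  wedge-degree {zero}  a m ω p s q = p s q
  wedge-degree {suc k} a m ω p s q = wedge-degree (tail a) (suc m) (a zero ∧ ω)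
    (∧-degree 0 m (a zero) ω p) s (λ e → q (≡.trans e (ℕ.+-suc k m)))

  1E-degree : ∀ {n} (s : Subset n) → ∣ s ∣ ≢ 0 → 1E s ≈ 0#
  1E-degree []          p = ⊥-elim (p ≡.refl)
  1E-degree (false ∷ s) p = 1E-degree s p
  1E-degree (true ∷ s)  p = refl

  wedge-1E-degree : ∀ {k n} (a : Fin k → Vect n) s → ∣ s ∣ ≢ k → wedge a 1E s ≈ 0#
  wedge-1E-degree {k} a s p = wedge-degree a 0 1E 1E-degree s (λ e → p (≡.trans e (ℕ.+-identityʳ k)))

  -- The product of the vectors is homogeneous of degree `k`, and no subset of an `n`-element set
  -- has so many elements.
  too-many-dependent : ∀ {k n} (a : Fin k → Vect n) → n < k → ¬ ¬ Dependent a
  too-many-dependent a n<k = wedge≈0⇒dependent a λ s →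
    wedge-1E-degree a s (ℕ.<⇒≢ (ℕ.≤-<-trans (∣p∣≤n s) n<k))

  -- Up to sign `det` is the determinant; by degree it is the only coefficient of the product that
  -- can be nonzero. Its vanishing would yield a nontrivial relation, if only up to double negation.
  -- That suffices to refute `det ≈ 0#`, and `inverse` asks for no more.
  independent-stable : ∀ {n} (a : Fin n → Vect n) → (∀ v → comb v a ≈V 0V → ¬ ¬ (v ≈V 0V)) →
    ∀ v → comb v a ≈V 0V → v ≈V 0V
  independent-stable {n} a indep v va≈0 j = begin
    v j                  ≈⟨ *-identityʳ _ ⟨
    v j * 1#             ≈⟨ *-congˡ (proj₂ det⁻¹) ⟨
    v j * (det * q)      ≈⟨ *-assoc _ _ _ ⟨
    v j * det * q        ≈⟨ *-congʳ (cramer v a 1E (∧-zeroˡ 1E va≈0) j ⊤) ⟩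
    0# * q               ≈⟨ zeroˡ q ⟩
    0#                   ∎
    where
    det = wedge a 1E ⊤
    det≉0 : ¬ det ≈ 0#
    det≉0 det≈0 = wedge≈0⇒dependent a wedge≈0 λ (u , (i , uᵢ≉0) , ua≈0) → indep u ua≈0 λ u≈0 → uᵢ≉0 (u≈0 i)
      where
      wedge≈0 : wedge a 1E ≈E 0E
      wedge≈0 s with ∣ s ∣ ℕ.≟ n
      ... | yes e = trans (reflexive (≡.cong (wedge a 1E) (∣p∣≡n⇒p≡⊤ e))) det≈0
      ... | no ¬e = wedge-1E-degree a s ¬e
    det⁻¹ = inverse det det≉0
    q = proj₁ det⁻¹

  -- Roots of polynomials

  horner : ∀ {k} → (Fin (suc k) → Carrier) → Carrier → Carrier
  horner {zero}  b t = b zero + t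
  horner {suc k} b t = b zero + t * horner (λ i → b (suc i)) t

  record Coeffs (k : ℕ) : Set c where
    constructor coeffs
    field coeff : Fin (suc k) → Carrier
  open Coeffs

  -- evalMonic is defined through a local function that cannot be named here. It carries the degree
  -- and coefficients of the outer call along; abstracting these (the record keeps the type of the
  -- tail from mentioning the outer degree) makes it the unique solution of the underscore below.
  mutual
    evalMonic≈horner : ∀ {k} a₀ (w : Coeffs k) t →
      evalMonic (a₀ ◂ coeff w) t ≈ a₀ + t * horner (coeff w) t
    evalMonic≈horner {k} a₀ w t with suc k | a₀ ◂ coeff w
    ... | d | a = +-congˡ (*-congˡ (go≈horner d a t k (coeff w)))

    go≈horner : ∀ d (a : Fin (suc d) → Carrier) t k (b : Fin (suc k) → Carrier) → _ ≈ horner b t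
    go≈horner d a t zero    b = refl
    go≈horner d a t (suc k) b = +-congˡ (*-congˡ (go≈horner d a t k (λ i → b (suc i))))

  root : ∀ {k} (b : Fin (suc k) → Carrier) → Σ Carrier λ t → horner b t ≈ 0#
  root {zero} b = algClosed zero b
  -- The coefficients are rebuilt from head and tail because `evalMonic≈horner` speaks of that form,
  -- which is not definitionally equal to `b`.
  root {suc k} b with algClosed (suc k) (b zero ◂ (λ i → b (suc i)))
  ... | t , eq = t , trans (sym (evalMonic≈horner (b zero) (coeffs (λ i → b (suc i))) t)) eq

  -- Linear maps and the Sylvester equation

  record IsLinear {m n} (T : Vect m → Vect n) : Set (c ⊔ ℓ) where
    field
      cong     : ∀ {u v} → u ≈V v → T u ≈V T v
      preserve : ∀ a u b v → T (lin a u b v) ≈V lin a (T u) b (T v)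

    zero-homo : ∀ {v} → v ≈V 0V → T v ≈V 0V
    zero-homo {v} v≈0 i = begin
      T v i                      ≈⟨ cong (λ j → trans (v≈0 j) (solve 1 (λ x → con (+ 0) := con (+ 0) :* x :+ con (+ 0) :* x) refl (v j))) i ⟩
      T (lin 0# v 0# v) i        ≈⟨ preserve 0# v 0# v i ⟩
      0# * T v i + 0# * T v i    ≈⟨ solve 1 (λ x → con (+ 0) :* x :+ con (+ 0) :* x := con (+ 0)) refl (T v i) ⟩
      0#                         ∎

    comb-homo : ∀ {k} (v : Vect k) (a : Fin k → Vect m) → T (comb v a) ≈V comb v (T ∘ a)
    comb-homo {zero}  v a   = zero-homo (λ _ → refl)
    comb-homo {suc k} v a i = begin
      T (comb v a) i
        ≈⟨ cong (λ j → +-congˡ (sym (*-identityˡ _))) i ⟩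
      T (lin (v zero) (a zero) 1# (comb (tail v) (tail a))) i
        ≈⟨ preserve _ _ _ _ i ⟩
      v zero * T (a zero) i + 1# * T (comb (tail v) (tail a)) i
        ≈⟨ +-congˡ (trans (*-identityˡ _) (comb-homo (tail v) (tail a) i)) ⟩
      v zero * T (a zero) i + comb (tail v) (T ∘ tail a) i ∎

  open IsLinear

  δ-sym : ∀ {m} (i j : Fin m) → δ i j ≈ δ j i
  δ-sym i j with i ≟ j | j ≟ i
  ... | yes _   | yes _   = refl
  ... | yes i≡j | no j≢i  = ⊥-elim (j≢i (≡.sym i≡j))
  ... | no i≢j  | yes j≡i = ⊥-elim (i≢j (≡.sym j≡i))
  ... | no _    | no _    = refl

  comb-δ : ∀ {m} (v : Vect m) → comb v δ ≈V v
  comb-δ {m} v i = trans (sumF-cong {m} (λ j → trans (*-comm _ _) (*-congʳ (δ-sym j i)))) (sumF-δ i v)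

  -- `independent-stable`, applied to the images of the standard basis vectors.
  linear-stable : ∀ {n} {T : Vect n → Vect n} → IsLinear T → (∀ v → T v ≈V 0V → ¬ ¬ (v ≈V 0V)) →
    ∀ v → T v ≈V 0V → v ≈V 0V
  linear-stable {T = T} L inj v Tv≈0 =
    independent-stable (T ∘ δ) (λ u p → inj u (λ i → trans (T≈comb u i) (p i)))
      v (λ i → trans (sym (T≈comb v i)) (Tv≈0 i))
    where
    T≈comb : ∀ u → T u ≈V comb u (T ∘ δ)
    T≈comb u i = trans (cong L (λ j → sym (comb-δ u j)) i) (comb-homo L u δ i)

  -- The rectangular counterpart of `_⊙_`, as `_∙_` below is of `_·_`; on square matrices they agree
  -- by definition, so the lemmas serve both.
  apply : ∀ {m n} → (Fin m → Vect n) → Vect n → Vect m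
  apply A v i = sumF (λ k → A i k * v k)

  apply-linear : ∀ {m n} (A : Fin m → Vect n) → IsLinear (apply A)
  apply-linear {n = n} A = record
    { cong     = λ p i → sumF-cong {n} (λ k → *-congˡ (p k))
    ; preserve = λ a u b v i → trans
        (sumF-cong {n} (λ k → solve 5 (λ x a u b v → x :* (a :* u :+ b :* v) := a :* (x :* u) :+ b :* (x :* v))
                           refl (A i k) a (u k) b (v k)))
        (sumF-lin {n} a _ b _)
    }

  infixl 7 _∙_
  _∙_ : ∀ {l m n} → (Fin l → Vect m) → (Fin m → Vect n) → Fin l → Vect n
  (A ∙ B) i j = sumF (λ k → A i k * B k j)

  apply-∙ : ∀ {l m n} (A : Fin l → Vect m) (B : Fin m → Vect n) v → apply (A ∙ B) v ≈V apply A (apply B v)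
  apply-∙ {l} {m} {n} A B v i = begin
    sumF (λ k → sumF (λ j → A i j * B j k) * v k)
      ≈⟨ sumF-cong {n} (λ k → trans (*-comm _ _) (sym (sumF-*ˡ {m} (v k) _))) ⟩
    sumF (λ k → sumF (λ j → v k * (A i j * B j k)))
      ≈⟨ sumF-swap {n} {m} _ ⟩
    sumF (λ j → sumF (λ k → v k * (A i j * B j k)))
      ≈⟨ sumF-cong {m} (λ j → trans
           (sumF-cong {n} (λ k → solve 3 (λ v a b → v :* (a :* b) := a :* (b :* v)) refl (v k) (A i j) (B j k)))
           (sumF-*ˡ {n} (A i j) _)) ⟩
    sumF (λ j → A i j * sumF (λ k → B j k * v k)) ∎

  -- Products of factors `A - μ`.

  shift : ∀ {n} → Mat n → Carrier → Vect n → Vect n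
  shift A μ v = lin 1# (A ⊙ v) (- μ) v

  shift-cong : ∀ {n} (A : Mat n) μ {u v} → u ≈V v → shift A μ u ≈V shift A μ v
  shift-cong A μ p i = +-cong (*-congˡ (cong (apply-linear A) p i)) (*-congˡ (p i))

  shift-intertwine : ∀ {m n} {A : Mat n} {B : Mat m} {T : Vect n → Vect m} → IsLinear T →
    (∀ v → B ⊙ T v ≈V T (A ⊙ v)) → ∀ μ v → shift B μ (T v) ≈V T (shift A μ v)
  shift-intertwine L p μ v i = sym (trans (preserve L _ _ _ _ i) (+-congʳ (*-congˡ (sym (p v i)))))

  shift-linear : ∀ {n} (A : Mat n) μ → IsLinear (shift A μ)
  shift-linear A μ = record
    { cong     = shift-cong A μ
    ; preserve = λ a u b v i → trans (+-congʳ (*-congˡ (preserve (apply-linear A) a u b v i)))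
        (solve 7 (λ a b m x y u v → con (+ 1) :* (a :* x :+ b :* y) :+ :- m :* (a :* u :+ b :* v)
             := a :* (con (+ 1) :* x :+ :- m :* u) :+ b :* (con (+ 1) :* y :+ :- m :* v))
           refl a b μ _ _ (u i) (v i))
    }

  ⊙-shift : ∀ {n} (A : Mat n) μ v → A ⊙ shift A μ v ≈V shift A μ (A ⊙ v)
  ⊙-shift A μ v = preserve (apply-linear A) _ _ _ _

  shifts : ∀ {n} → Mat n → List Carrier → Vect n → Vect n
  shifts A []       v = v
  shifts A (μ ∷ μs) v = shifts A μs (shift A μ v)

  shifts-cong : ∀ {n} (A : Mat n) μs {u v} → u ≈V v → shifts A μs u ≈V shifts A μs v
  shifts-cong A []       p = p
  shifts-cong A (μ ∷ μs) p = shifts-cong A μs (shift-cong A μ p)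

  shifts-intertwine : ∀ {m n} {A : Mat n} {B : Mat m} {T : Vect n → Vect m} → IsLinear T →
    (∀ v → B ⊙ T v ≈V T (A ⊙ v)) → ∀ μs v → shifts B μs (T v) ≈V T (shifts A μs v)
  shifts-intertwine L p [] v i = refl
  shifts-intertwine {B = B} L p (μ ∷ μs) v i =
    trans (shifts-cong B μs (shift-intertwine L p μ v) i) (shifts-intertwine L p μs _ i)

  -- Polynomials annihilating a vector, and eigenvalues.

  module _ {n} (A : Mat n) where

    -- The Krylov sequence f, A f, A² f, ....
    powers : ∀ {k} → Vect n → Fin k → Vect n
    powers f zero    = f
    powers f (suc j) = powers (A ⊙ f) j

    -- The vector p(A) f for the monic polynomial p of degree `d` with lower coefficients `b`.
    monic : ∀ {d} → Vect d → Vect n → Vect n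
    monic {zero}  b f i = f i
    monic {suc d} b f i = b zero * f i + monic (tail b) (A ⊙ f) i

    monic-cong : ∀ {d} (b : Vect d) {f g} → f ≈V g → monic b f ≈V monic b g
    monic-cong {zero}  b p i = p i
    monic-cong {suc d} b p i = +-cong (*-congˡ (p i)) (monic-cong (tail b) (cong (apply-linear A) p) i)

    -- Which nonzero coefficient is the leading one cannot be decided, hence the double negation. If
    -- the tail has a nonzero entry, the recursion supplies the leading coefficient `x`, by which
    -- the constant term is divided; otherwise the constant term itself leads and the degree is 0.
    normalise : ∀ {k} (v : Vect k) → (∃ λ j → ¬ v j ≈ 0#) →
      ¬ ¬ (∃ λ d → Σ (Vect d) λ b → ∃ λ x → ¬ x ≈ 0# × ∀ f i → comb v (powers f) i ≈ x * monic b f i)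
    normalise {zero}  v (() , _)
    normalise {suc k} v (j , vⱼ≉0) ¬goal = vanish tail≉0⇒⊥ (tail≈0⇒⊥ j vⱼ≉0)
      where
      tail≉0⇒⊥ : ¬ (∃ λ j → ¬ v (suc j) ≈ 0#)
      tail≉0⇒⊥ nz = normalise (tail v) nz λ (d , b , x , x≉0 , p) →
        let y , xy≈1 = inverse x x≉0 in
        ¬goal (suc d , (y * v zero) ◂ b , x , x≉0 , λ f i → begin
          v zero * f i + comb (tail v) (powers (A ⊙ f)) i
            ≈⟨ +-cong (sym (*-identityˡ _)) (p (A ⊙ f) i) ⟩
          1# * (v zero * f i) + x * monic b (A ⊙ f) i
            ≈⟨ +-congʳ (*-congʳ xy≈1) ⟨
          x * y * (v zero * f i) + x * monic b (A ⊙ f) i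
            ≈⟨ solve 5 (λ x y v f m → x :* y :* (v :* f) :+ x :* m := x :* (y :* v :* f :+ m))
                 refl x y (v zero) (f i) _ ⟩
          x * (y * v zero * f i + monic b (A ⊙ f) i) ∎)

      tail≈0⇒⊥ : ∀ j → ¬ v j ≈ 0# → ¬ (tail v ≈V 0V)
      tail≈0⇒⊥ (suc j) vⱼ≉0 p = vⱼ≉0 (p j)
      tail≈0⇒⊥ zero    v₀≉0 p = ¬goal (0 , (λ ()) , v zero , v₀≉0 , λ f i →
        trans (+-congˡ (sumF-0 {k} (λ j → trans (*-congʳ (p j)) (zeroˡ _)))) (+-identityʳ _))

    -- Synthetic division by X - t: the quotient's coefficients are the intermediate values of
    -- Horner's scheme.
    divide : ∀ {d} → Vect (suc d) → Carrier → Vect d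
    divide {zero}  b t = λ ()
    divide {suc d} b t = horner (tail b) t ◂ divide (tail b) t

    -- Division with remainder, p = q (X - t) + p(t), evaluated at `A` on `f`.
    monic-divide : ∀ {d} (b : Vect (suc d)) t f i →
      monic b f i ≈ monic (divide b t) (shift A t f) i + horner b t * f i
    monic-divide {zero} b t f i =
      solve 4 (λ b t f g → b :* f :+ g := con (+ 1) :* g :+ :- t :* f :+ (b :+ t) :* f) refl (b zero) t (f i) ((A ⊙ f) i)
    monic-divide {suc d} b t f i = begin
      b zero * f i + monic (tail b) (A ⊙ f) i
        ≈⟨ +-congˡ (monic-divide (tail b) t (A ⊙ f) i) ⟩
      b zero * f i + (monic q (shift A t (A ⊙ f)) i + r * (A ⊙ f) i)
        ≈⟨ +-congˡ (+-congʳ (monic-cong q (λ j → sym (⊙-shift A t f j)) i)) ⟩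
      b zero * f i + (monic q (A ⊙ shift A t f) i + r * (A ⊙ f) i)
        ≈⟨ solve 6 (λ b t f g r m → b :* f :+ (m :+ r :* g)
             := r :* (con (+ 1) :* g :+ :- t :* f) :+ m :+ (b :+ t :* r) :* f)
             refl (b zero) t (f i) ((A ⊙ f) i) r _ ⟩
      r * shift A t f i + monic q (A ⊙ shift A t f) i + (b zero + t * r) * f i ∎
      where
      q = divide (tail b) t
      r = horner (tail b) t

    -- Algebraic closedness supplies a root t of p; the quotient by X - t has smaller degree and
    -- annihilates (A - t) f.
    split : ∀ {d} (b : Vect d) f → monic b f ≈V 0V → ∃ λ μs → shifts A μs f ≈V 0V
    split {zero}  b f p = [] , p
    split {suc d} b f p =
      let t , bt≈0 = root b
          μs , q   = split (divide b t) (shift A t f) λ i → begin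
            monic (divide b t) (shift A t f) i
              ≈⟨ solve 2 (λ x y → x := x :+ con (+ 0) :* y) refl _ (f i) ⟩
            monic (divide b t) (shift A t f) i + 0# * f i
              ≈⟨ +-congˡ (*-congʳ bt≈0) ⟨
            monic (divide b t) (shift A t f) i + horner b t * f i
              ≈⟨ monic-divide b t f i ⟨
            monic b f i
              ≈⟨ p i ⟩
            0# ∎
      in t ∷ μs , q

    -- The n + 1 vectors f, A f, ..., Aⁿ f are dependent, which gives a nonzero polynomial
    -- annihilating `f`. It may depend on `f`, so no Cayley-Hamilton theorem is called for.
    annihilated : ∀ f → ¬ ¬ (∃ λ μs → shifts A μs f ≈V 0V)
    annihilated f ¬goal = too-many-dependent (powers {suc n} f) ℕ.≤-refl λ (v , nz , vf≈0) →
      normalise v nz λ (d , b , x , x≉0 , p) →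
      let y , xy≈1 = inverse x x≉0 in
      ¬goal (split b f λ i → begin
        monic b f i                ≈⟨ *-identityˡ _ ⟨
        1# * monic b f i           ≈⟨ *-congʳ xy≈1 ⟨
        x * y * monic b f i        ≈⟨ solve 3 (λ x y m → x :* y :* m := y :* (x :* m)) refl x y _ ⟩
        y * (x * monic b f i)      ≈⟨ *-congˡ (trans (sym (p f i)) (vf≈0 i)) ⟩
        y * 0#                     ≈⟨ zeroʳ y ⟩
        0#                         ∎)

    shift≈0⇒eigenvector : ∀ {μ v} → shift A μ v ≈V 0V → ∀ i → (A ⊙ v) i ≈ μ * v i
    shift≈0⇒eigenvector {μ} {v} p i = begin
      (A ⊙ v) i                             ≈⟨ solve 3 (λ g m f → g := con (+ 1) :* g :+ :- m :* f :+ m :* f) refl _ μ (v i) ⟩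
      1# * (A ⊙ v) i + - μ * v i + μ * v i  ≈⟨ +-congʳ (p i) ⟩
      0# + μ * v i                          ≈⟨ +-identityˡ _ ⟩
      μ * v i                               ∎

    -- A factor A - μ with μ not an eigenvalue is injective, so it can be cancelled.
    prune : ∀ μs f → shifts A μs f ≈V 0V →
      ¬ ¬ (∃ λ νs → All (IsEigenvalue A) νs × shifts A νs f ≈V 0V)
    prune []       f p ¬goal = ¬goal ([] , [] , p)
    prune (μ ∷ μs) f p ¬goal = prune μs (shift A μ f) p λ (νs , ev , q) →
      vanish
        -- If the remaining factors do not kill `f`, they send it to an eigenvector for `μ`, because
        -- they commute with `A - μ`.
        (λ nz → ¬goal (μ ∷ νs , (shifts A νs f , nz , shift≈0⇒eigenvector λ i →
          trans (sym (shifts-intertwine (shift-linear A μ) (⊙-shift A μ) νs f i)) (q i)) ∷ ev , q))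
        (λ z → ¬goal (νs , ev , z))

    shifts-injective : ∀ νs f → All (λ ν → ¬ IsEigenvalue A ν) νs → shifts A νs f ≈V 0V → ¬ ¬ (f ≈V 0V)
    shifts-injective []       f []          p ¬goal = ¬goal p
    shifts-injective (ν ∷ νs) f (¬ev ∷ ¬evs) p ¬goal =
      shifts-injective νs (shift A ν f) ¬evs p λ q →
        vanish (λ nz → ¬ev (f , nz , shift≈0⇒eigenvector q)) ¬goal

  -- Intertwiners of matrices with disjoint spectra.

  module _ {m n} (B : Mat m) (A : Mat n) (disjoint : ∀ μ → IsEigenvalue A μ → ¬ IsEigenvalue B μ) where

    -- For each `f` some product p of factors X - ν, with ν eigenvalues of `A`, has p(A) f = 0. Then
    -- p(B) G f = G p(A) f = 0, and p(B) is injective because no ν is an eigenvalue of `B`.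
    intertwiner-¬¬zero : (G : Fin m → Vect n) → (∀ i → (B ∙ G) i ≈V (G ∙ A) i) → ¬ ¬ (∀ i → G i ≈V 0V)
    intertwiner-¬¬zero G BG≈GA = ¬¬-map entries (¬¬-∀ (λ j → column (δ j)))
      where
      intertwines : ∀ v → B ⊙ apply G v ≈V apply G (A ⊙ v)
      intertwines v i = begin
        apply B (apply G v) i     ≈⟨ apply-∙ B G v i ⟨
        apply (B ∙ G) v i         ≈⟨ sumF-cong {n} (λ k → *-congʳ (BG≈GA i k)) ⟩
        apply (G ∙ A) v i         ≈⟨ apply-∙ G A v i ⟩
        apply G (apply A v) i     ∎

      column : ∀ f → ¬ ¬ (apply G f ≈V 0V)
      column f ¬goal = annihilated A f λ (μs , p) → prune A μs f p λ (νs , ev , q) →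
        shifts-injective B νs (apply G f) (All.map (disjoint _) ev)
          (λ i → trans (shifts-intertwine (apply-linear G) intertwines νs f i)
                       (zero-homo (apply-linear G) q i))
          ¬goal

      entries : (∀ j → apply G (δ j) ≈V 0V) → ∀ i → G i ≈V 0V
      entries p i j = trans (sym (sumF-δ j (G i))) (trans (sumF-cong {n} (λ k → *-comm _ _)) (p j i))

    -- Matrices are flattened to vectors so that the Sylvester operator becomes an endomorphism to
    -- which `linear-stable` applies.
    curried : Vect (m ℕ.* n) → Fin m → Vect n
    curried v i j = v (combine i j)

    defect : Vect (m ℕ.* n) → Fin m × Fin n → Carrier
    defect v (i , j) = (B ∙ curried v) i j - (curried v ∙ A) i j

    sylvester : Vect (m ℕ.* n) → Vect (m ℕ.* n)
    sylvester v = defect v ∘ remQuot n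

    sylvester-linear : IsLinear sylvester
    sylvester-linear = record
      { cong     = λ p k → +-cong (sumF-cong {m} (λ r → *-congˡ (p _))) (-‿cong (sumF-cong {n} (λ s → *-congʳ (p _))))
      ; preserve = λ a u b v k → trans
          (+-cong (preserve (apply-linear B) a _ b _ _)
             (-‿cong (trans (sumF-cong {n} (λ s → solve 5 (λ x a u b v → (a :* u :+ b :* v) :* x := a :* (u :* x) :+ b :* (v :* x))
                           refl (A s (proj₂ (remQuot {m} n k))) a (u _) b (v _))) (sumF-lin {n} a _ b _))))
          (solve 6 (λ a b p q r s → a :* p :+ b :* q :- (a :* r :+ b :* s) := a :* (p :- r) :+ b :* (q :- s))
             refl a b _ _ _ _)
      }

    intertwiner-zero : (G : Fin m → Vect n) → (∀ i → (B ∙ G) i ≈V (G ∙ A) i) → ∀ i → G i ≈V 0V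
    intertwiner-zero G BG≈GA i j = trans (sym (curried-v i j))
      (linear-stable sylvester-linear injective v (λ k → sylvester-v (remQuot n k)) (combine i j))
      where
      v : Vect (m ℕ.* n)
      v = uncurry G ∘ remQuot n

      curried-v : ∀ i j → curried v i j ≈ G i j
      curried-v i j = reflexive (≡.cong (uncurry G) (remQuot-combine i j))

      sylvester-v : ∀ ij → defect v ij ≈ 0#
      sylvester-v (i , j) = begin
        (B ∙ curried v) i j - (curried v ∙ A) i j
          ≈⟨ +-cong (sumF-cong {m} (λ k → *-congˡ (curried-v k j)))
                    (-‿cong (sumF-cong {n} (λ k → *-congʳ (curried-v i k)))) ⟩
        (B ∙ G) i j - (G ∙ A) i j  ≈⟨ +-congʳ (BG≈GA i j) ⟩
        (G ∙ A) i j - (G ∙ A) i j  ≈⟨ -‿inverseʳ _ ⟩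
        0#                         ∎

      injective : ∀ u → sylvester u ≈V 0V → ¬ ¬ (u ≈V 0V)
      injective u p ¬u≈0 = intertwiner-¬¬zero (curried u)
        (λ i j → x∙y⁻¹≈ε⇒x≈y _ _
          (trans (reflexive (≡.cong (defect u) (≡.sym (remQuot-combine i j)))) (p (combine i j))))
        (λ q → ¬u≈0 (λ k → trans (reflexive (≡.cong u (≡.sym (combine-remQuot {m} n k)))) (uncurry q (remQuot n k))))

  -- Commutation with diag(1, …, 1, 0)

  δ-≢ : ∀ {m} {i j : Fin m} → i ≢ j → δ i j ≈ 0#
  δ-≢ {i = i} {j} i≢j with i ≟ j
  ... | yes i≡j = ⊥-elim (i≢j i≡j)
  ... | no _    = refl

  δ-inject₁ : ∀ {m} (i j : Fin m) → δ (inject₁ i) (inject₁ j) ≈ δ i j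
  δ-inject₁ i j with i ≟ j
  ... | yes ≡.refl = δ-refl (inject₁ i)
  ... | no i≢j     = δ-≢ (i≢j ∘ inject₁-injective)

  unlast-fromℕ : ∀ n → unlast (fromℕ n) ≡ nothing
  unlast-fromℕ zero    = ≡.refl
  unlast-fromℕ (suc n) = ≡.cong (Maybe.map suc) (unlast-fromℕ n)

  unlast-inject₁ : ∀ {n} (i : Fin n) → unlast (inject₁ i) ≡ just i
  unlast-inject₁ zero    = ≡.refl
  unlast-inject₁ (suc i) = ≡.cong (Maybe.map suc) (unlast-inject₁ i)

  ι-lastˡ : ∀ {n} (y : Mat n) j → ι y (fromℕ n) j ≈ 0#
  ι-lastˡ {n} y j rewrite unlast-fromℕ n = refl

  ι-lastʳ : ∀ {n} (y : Mat n) i → ι y i (fromℕ n) ≈ 0#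
  ι-lastʳ {n} y i rewrite unlast-fromℕ n with unlast i
  ... | just _  = refl
  ... | nothing = refl

  ι-inject₁ : ∀ {n} (y : Mat n) i j → ι y (inject₁ i) (inject₁ j) ≈ y i j
  ι-inject₁ y i j rewrite unlast-inject₁ i | unlast-inject₁ j = refl

  sumF-last : ∀ {n} (f : Vect (suc n)) → sumF f ≈ sumF (f ∘ inject₁) + f (fromℕ n)
  sumF-last {zero}  f = +-comm _ _
  sumF-last {suc n} f = trans (+-congˡ (sumF-last (f ∘ suc))) (sym (+-assoc _ _ _))

  sumF-lin₃ : ∀ {m} a a' (f : Vect m) b' g b h →
    sumF (lin a (lin a' f b' g) b h) ≈ a * (a' * sumF f + b' * sumF g) + b * sumF h
  sumF-lin₃ a a' f b' g b h = trans (sumF-lin a (lin a' f b' g) b h) (+-congʳ (*-congˡ (sumF-lin a' f b' g)))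

  -- With the diagonal of z as a function, the entries of [z, τ] are (ζ i - ζ j) τ i j, and no case
  -- distinction on indices is needed until the last row and column are examined.
  ζ : ∀ {n} → Vect (suc n)
  ζ i = zMat i i

  ζ-last : ∀ n → ζ (fromℕ n) ≈ 0#
  ζ-last n = ι-lastˡ {n} δ (fromℕ n)

  ζ-inject₁ : ∀ {n} (i : Fin n) → ζ (inject₁ i) ≈ 1#
  ζ-inject₁ i = trans (ι-inject₁ δ i i) (δ-refl i)

  zMat-diagonal : ∀ {n} (i j : Fin (suc n)) → zMat i j ≈ ζ i * δ i j
  zMat-diagonal {n} i j with view i | view j
  ... | ‵fromℕ     | _          = trans (ι-lastˡ {n} δ j) (sym (trans (*-congʳ (ζ-last n)) (zeroˡ _)))
  ... | ‵inject₁ i | ‵fromℕ     = trans (ι-lastʳ {n} δ (inject₁ i))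
    (sym (trans (*-congˡ (δ-≢ {i = inject₁ i} {fromℕ n} (fromℕ≢inject₁ ∘ ≡.sym))) (zeroʳ _)))
  ... | ‵inject₁ i | ‵inject₁ j = trans (ι-inject₁ δ i j)
    (sym (trans (*-cong (ζ-inject₁ i) (δ-inject₁ i j)) (*-identityˡ _)))

  zMat-· : ∀ {n} (A : Mat (suc n)) i j → (zMat · A) i j ≈ ζ i * A i j
  zMat-· {n} A i j = begin
    sumF (λ k → zMat i k * A k j)       ≈⟨ sumF-cong {suc n} (λ k → trans (*-congʳ (zMat-diagonal i k)) (*-assoc _ _ (A k j))) ⟩
    sumF (λ k → ζ i * (δ i k * A k j))  ≈⟨ sumF-*ˡ (ζ i) (λ k → δ i k * A k j) ⟩
    ζ i * sumF (λ k → δ i k * A k j)    ≈⟨ *-congˡ (sumF-δ i (λ k → A k j)) ⟩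
    ζ i * A i j                         ∎

  ·-zMat : ∀ {n} (A : Mat (suc n)) i j → (A · zMat) i j ≈ ζ j * A i j
  ·-zMat {n} A i j = begin
    sumF (λ k → A i k * zMat k j)
      ≈⟨ sumF-cong {suc n} (λ k → trans (*-congˡ (trans (zMat-diagonal k j) (*-congˡ (δ-sym k j))))
           (solve 3 (λ a z d → a :* (z :* d) := d :* (z :* a)) refl (A i k) (ζ k) (δ j k))) ⟩
    sumF (λ k → δ j k * (ζ k * A i k))  ≈⟨ sumF-δ j (λ k → ζ k * A i k) ⟩
    ζ j * A i j                         ∎

  -- Matrices commuting with `τ`, and the conclusion.

  module _ {n} (τ x : Mat (suc n)) (y : Mat n) (xτ≈τx : ∀ i j → (x · τ) i j ≈ (τ · x) i j)
           (hyp : [ x , [ zMat , τ ] ] ≈M [ ι y , τ ]) where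

    d : Carrier
    d = x (fromℕ n) (fromℕ n)

    -- This is [x, z] - y, with the commutator with the diagonal matrix z written out.
    W : Mat (suc n)
    W i j = x i j * (ζ j - ζ i) - ι y i j

    -- As [x, τ] = 0, the Jacobi identity reads [x, [z, τ]] = [[x, z], τ]. In entries, `S₁` belongs
    -- to x z τ and `S₂` to τ z x; all other terms with z are multiples of `xτ` or `τx`.
    W-commutes : ∀ i j → (W · τ) i j ≈ (τ · W) i j
    W-commutes i j = begin
      (W · τ) i j
        ≈⟨ sumF-cong {suc n} (λ k → solve 5 (λ x a b y t → (x :* (a :- b) :- y) :* t
               := con (+ 1) :* (con (+ 1) :* (x :* a :* t) :+ :- b :* (x :* t)) :+ :- con (+ 1) :* (y :* t))
             refl (x i k) (ζ k) (ζ i) (ι y i k) (τ k j)) ⟩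
      sumF (lin 1# (lin 1# s₁ (- ζ i) (λ k → x i k * τ k j)) (- 1#) (λ k → ι y i k * τ k j))
        ≈⟨ sumF-lin₃ 1# 1# s₁ (- ζ i) (λ k → x i k * τ k j) (- 1#) (λ k → ι y i k * τ k j) ⟩
      1# * (1# * S₁ + - ζ i * xτ) + - 1# * yτ
        -- `ζ j * xτ` and `S₂` are added and subtracted to exhibit the left side of `hyp'`.
        ≈⟨ solve 6 (λ s t zᵢ zⱼ c y → con (+ 1) :* (con (+ 1) :* s :+ :- zᵢ :* c) :+ :- con (+ 1) :* y
               := con (+ 1) :* s :+ :- zⱼ :* c :- (zᵢ :* c :+ :- con (+ 1) :* t) :+ (zⱼ :* c :- t :- y))
             refl S₁ S₂ (ζ i) (ζ j) xτ yτ ⟩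
      1# * S₁ + - ζ j * xτ - (ζ i * xτ + - 1# * S₂) + (ζ j * xτ - S₂ - yτ)
        ≈⟨ +-congʳ hyp' ⟩
      yτ - τy + (ζ j * xτ - S₂ - yτ)
        ≈⟨ +-congˡ (+-congʳ (+-congʳ (*-congˡ (xτ≈τx i j)))) ⟩
      yτ - τy + (ζ j * τx - S₂ - yτ)
        ≈⟨ solve 5 (λ zⱼ t c y y' → y :- y' :+ (zⱼ :* c :- t :- y)
               := con (+ 1) :* (zⱼ :* c :+ :- con (+ 1) :* t) :+ :- con (+ 1) :* y')
             refl (ζ j) S₂ τx yτ τy ⟩
      1# * (ζ j * τx + - 1# * S₂) + - 1# * τy
        ≈⟨ sumF-lin₃ 1# (ζ j) (λ k → τ i k * x k j) (- 1#) s₂ (- 1#) (λ k → τ i k * ι y k j) ⟨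
      sumF (lin 1# (lin (ζ j) (λ k → τ i k * x k j) (- 1#) s₂) (- 1#) (λ k → τ i k * ι y k j))
        ≈⟨ sumF-cong {suc n} (λ k → solve 5 (λ x a b y t →
               con (+ 1) :* (b :* (t :* x) :+ :- con (+ 1) :* (t :* a :* x)) :+ :- con (+ 1) :* (t :* y)
               := t :* (x :* (b :- a) :- y))
             refl (x k j) (ζ k) (ζ j) (ι y k j) (τ i k)) ⟩
      (τ · W) i j ∎
      where
      s₁ s₂ : Vect (suc n)
      s₁ k = x i k * ζ k * τ k j
      s₂ k = τ i k * ζ k * x k j
      S₁ = sumF s₁
      S₂ = sumF s₂
      xτ = (x · τ) i j
      τx = (τ · x) i j
      yτ = (ι y · τ) i j
      τy = (τ · ι y) i j

      [z,τ] : ∀ i j → [ zMat , τ ] i j ≈ ζ i * τ i j - ζ j * τ i j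
      [z,τ] i j = +-cong (zMat-· τ i j) (-‿cong (·-zMat τ i j))

      hyp' : 1# * S₁ + - ζ j * xτ - (ζ i * xτ + - 1# * S₂) ≈ yτ - τy
      hyp' = begin
        1# * S₁ + - ζ j * xτ - (ζ i * xτ + - 1# * S₂)
          ≈⟨ +-congˡ (-‿cong (+-congʳ (*-congˡ (xτ≈τx i j)))) ⟩
        1# * S₁ + - ζ j * xτ - (ζ i * τx + - 1# * S₂)
          ≈⟨ +-cong (sumF-lin 1# s₁ (- ζ j) (λ k → x i k * τ k j)) (-‿cong (sumF-lin (ζ i) (λ k → τ i k * x k j) (- 1#) s₂)) ⟨
        sumF (lin 1# s₁ (- ζ j) (λ k → x i k * τ k j)) - sumF (lin (ζ i) (λ k → τ i k * x k j) (- 1#) s₂)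
          ≈⟨ +-cong
               (sumF-cong {suc n} (λ k → trans
                 (solve 4 (λ x a b t → con (+ 1) :* (x :* a :* t) :+ :- b :* (x :* t) := x :* (a :* t :- b :* t))
                   refl (x i k) (ζ k) (ζ j) (τ k j))
                 (*-congˡ (sym ([z,τ] k j)))))
               (-‿cong (sumF-cong {suc n} (λ k → trans
                 (solve 4 (λ x a b t → b :* (t :* x) :+ :- con (+ 1) :* (t :* a :* x) := (b :* t :- a :* t) :* x)
                   refl (x k j) (ζ k) (ζ i) (τ i k))
                 (*-congʳ (sym ([z,τ] i k)))))) ⟩
        [ x , [ zMat , τ ] ] i j
          ≈⟨ hyp i j ⟩
        yτ - τy ∎

    -- Only `s` = 1 and `s` = -1 matter; the parameter lets one computation prove both commutation
    -- relations.
    W± : Carrier → Mat (suc n)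
    W± s i j = W i j + s * (x i j - d * δ i j)

    W±-commutes : ∀ s i j → (W± s · τ) i j ≈ (τ · W± s) i j
    W±-commutes s i j = begin
      (W± s · τ) i j
        ≈⟨ sumF-cong {suc n} (λ k → solve 6 (λ w s x d e t → (w :+ s :* (x :- d :* e)) :* t
               := s :* (con (+ 1) :* (x :* t) :+ :- d :* (e :* t)) :+ con (+ 1) :* (w :* t))
             refl (W i k) s (x i k) d (δ i k) (τ k j)) ⟩
      sumF (lin s (lin 1# (λ k → x i k * τ k j) (- d) (λ k → δ i k * τ k j)) 1# (λ k → W i k * τ k j))
        ≈⟨ sumF-lin₃ s 1# (λ k → x i k * τ k j) (- d) (λ k → δ i k * τ k j) 1# (λ k → W i k * τ k j) ⟩
      s * (1# * (x · τ) i j + - d * (δ · τ) i j) + 1# * (W · τ) i j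
        ≈⟨ +-cong (*-congˡ (+-cong (*-congˡ (xτ≈τx i j)) (*-congˡ δτ≈τδ))) (*-congˡ (W-commutes i j)) ⟩
      s * (1# * (τ · x) i j + - d * (τ · δ) i j) + 1# * (τ · W) i j
        ≈⟨ sumF-lin₃ s 1# (λ k → τ i k * x k j) (- d) (λ k → τ i k * δ k j) 1# (λ k → τ i k * W k j) ⟨
      sumF (lin s (lin 1# (λ k → τ i k * x k j) (- d) (λ k → τ i k * δ k j)) 1# (λ k → τ i k * W k j))
        ≈⟨ sumF-cong {suc n} (λ k → solve 6 (λ w s x d e t →
               s :* (con (+ 1) :* (t :* x) :+ :- d :* (t :* e)) :+ con (+ 1) :* (t :* w)
               := t :* (w :+ s :* (x :- d :* e)))
             refl (W k j) s (x k j) d (δ k j) (τ i k)) ⟩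
      (τ · W± s) i j ∎
      where
      δτ≈τδ : (δ · τ) i j ≈ (τ · δ) i j
      δτ≈τδ = trans (sumF-δ i (λ k → τ k j)) (sym (comb-δ (τ i) j))

    -- Away from the corner, [x, z] equals -x in the last column and x in the last row, while `ι y`
    -- vanishes in both. So the sign 1 cancels the column and -1 the row. In the corner [x, z] is 0,
    -- and x - d vanishes by the choice of `d`.
    W⁺-last-column : ∀ i → W± 1# i (fromℕ n) ≈ 0#
    W⁺-last-column i with view i
    ... | ‵fromℕ     = trans
      (+-cong (+-congˡ (-‿cong (ι-lastʳ y (fromℕ n)))) (*-congˡ (+-congˡ (-‿cong (*-congˡ (δ-refl (fromℕ n)))))))
      (solve 2 (λ d z → d :* (z :- z) :- con (+ 0) :+ con (+ 1) :* (d :- d :* con (+ 1)) := con (+ 0)) refl d (ζ (fromℕ n)))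
    ... | ‵inject₁ i = trans
      (+-cong (+-cong (*-congˡ (+-cong (ζ-last n) (-‿cong (ζ-inject₁ i)))) (-‿cong (ι-lastʳ y (inject₁ i))))
              (*-congˡ (+-congˡ (-‿cong (*-congˡ (δ-≢ {i = inject₁ i} {fromℕ n} (fromℕ≢inject₁ ∘ ≡.sym)))))))
      (solve 2 (λ d x → x :* (con (+ 0) :- con (+ 1)) :- con (+ 0) :+ con (+ 1) :* (x :- d :* con (+ 0)) := con (+ 0))
        refl d (x (inject₁ i) (fromℕ n)))

    W⁻-last-row : ∀ j → W± (- 1#) (fromℕ n) j ≈ 0#
    W⁻-last-row j with view j
    ... | ‵fromℕ     = trans
      (+-cong (+-congˡ (-‿cong (ι-lastʳ y (fromℕ n)))) (*-congˡ (+-congˡ (-‿cong (*-congˡ (δ-refl (fromℕ n)))))))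
      (solve 2 (λ d z → d :* (z :- z) :- con (+ 0) :+ :- con (+ 1) :* (d :- d :* con (+ 1)) := con (+ 0)) refl d (ζ (fromℕ n)))
    ... | ‵inject₁ j = trans
      (+-cong (+-cong (*-congˡ (+-cong (ζ-inject₁ j) (-‿cong (ζ-last n)))) (-‿cong (ι-lastˡ y (inject₁ j))))
              (*-congˡ (+-congˡ (-‿cong (*-congˡ (δ-≢ {i = fromℕ n} {inject₁ j} fromℕ≢inject₁))))))
      (solve 2 (λ d x → x :* (con (+ 1) :- con (+ 0)) :- con (+ 0) :+ :- con (+ 1) :* (x :- d :* con (+ 0)) := con (+ 0))
        refl d (x (fromℕ n) (inject₁ j)))

    module _ (disjoint : ∀ μ → IsEigenvalue τ μ → ¬ IsEigenvalue (upperLeft τ) μ) where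

      W⁺≈0 : ∀ i j → W± 1# i j ≈ 0#
      W⁺≈0 i j with view j
      ... | ‵fromℕ     = W⁺-last-column i
      -- The block now acts on the right, so disjointness is used with its two sides exchanged. The
      -- zero last column removes the last summand of the product with `τ`, leaving the product with
      -- the block.
      ... | ‵inject₁ j = intertwiner-zero τ (upperLeft τ) (λ μ p q → disjoint μ q p)
        (λ i j → W± 1# i (inject₁ j)) (λ i j → begin
          (τ · W± 1#) i (inject₁ j)  ≈⟨ W±-commutes 1# i (inject₁ j) ⟨
          (W± 1# · τ) i (inject₁ j)  ≈⟨ sumF-last (λ k → W± 1# i k * τ k (inject₁ j)) ⟩
          _ + W± 1# i (fromℕ n) * τ (fromℕ n) (inject₁ j)
            ≈⟨ +-congˡ (trans (*-congʳ (W⁺-last-column i)) (zeroˡ _)) ⟩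
          _ + 0#                     ≈⟨ +-identityʳ _ ⟩
          sumF (λ k → W± 1# i (inject₁ k) * upperLeft τ k j) ∎) i j

      W⁻≈0 : ∀ i j → W± (- 1#) i j ≈ 0#
      W⁻≈0 i j with view i
      ... | ‵fromℕ     = W⁻-last-row j
      ... | ‵inject₁ i = intertwiner-zero (upperLeft τ) τ disjoint
        (λ i j → W± (- 1#) (inject₁ i) j) (λ i j → sym (begin
          (W± (- 1#) · τ) (inject₁ i) j  ≈⟨ W±-commutes (- 1#) (inject₁ i) j ⟩
          (τ · W± (- 1#)) (inject₁ i) j  ≈⟨ sumF-last (λ k → τ (inject₁ i) k * W± (- 1#) k j) ⟩
          _ + τ (inject₁ i) (fromℕ n) * W± (- 1#) (fromℕ n) j
            ≈⟨ +-congˡ (trans (*-congˡ (W⁻-last-row j)) (zeroʳ _)) ⟩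
          _ + 0#                         ≈⟨ +-identityʳ _ ⟩
          sumF (λ k → upperLeft τ i k * W± (- 1#) (inject₁ k) j) ∎)) i j

      scalar : IsScalar x
      scalar = d , λ i j → x∙y⁻¹≈ε⇒x≈y _ _ (let u = x i j - d * δ i j in begin
        u                                  ≈⟨ *-identityˡ u ⟨
        1# * u                             ≈⟨ *-congʳ (proj₂ half) ⟨
        natural 2 * proj₁ half * u
          -- `W` cancels in the difference, which is 2 (x - d); the nested sum is `natural 2`
          -- unfolded.
          ≈⟨ solve 3 (λ h u w → (con (+ 1) :+ (con (+ 1) :+ con (+ 0))) :* h :* u
                 := h :* (w :+ con (+ 1) :* u :- (w :+ :- con (+ 1) :* u)))
               refl (proj₁ half) u (W i j) ⟩
        proj₁ half * (W± 1# i j - W± (- 1#) i j)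
          ≈⟨ *-congˡ (+-cong (W⁺≈0 i j) (-‿cong (W⁻≈0 i j))) ⟩
        proj₁ half * (0# - 0#)             ≈⟨ *-congˡ (-‿inverseʳ 0#) ⟩
        proj₁ half * 0#                    ≈⟨ zeroʳ _ ⟩
        0#                                 ∎)
        -- `char0 k` concerns k + 1, so the argument 1 says that 2 is nonzero.
        where half = inverse (natural 2) (char0 1)

theorem2 : ∀ {c ℓ} (K : ACField c ℓ) (n : ℕ) →
    let open ACField K using (Carrier) in
    let open Matrices K in
    (τ x : Mat (suc n)) →
    (∀ (μ : Carrier) → IsEigenvalue τ μ → ¬ IsEigenvalue (upperLeft τ) μ) →
    [ x , τ ] ≈M (λ _ _ → ACField.0# K) →
    Σ (Mat n) (λ y → [ x , [ zMat , τ ] ] ≈M [ ι y , τ ]) →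
    IsScalar x
theorem2 K n τ x disjoint [x,τ]≈0 (y , hyp) =
  LinearAlgebra.scalar K τ x y (λ i j → x∙y⁻¹≈ε⇒x≈y _ _ ([x,τ]≈0 i j)) hyp disjoint
  where
  open ACField K using (+-group)
  open import Algebra.Properties.Group +-group using (x∙y⁻¹≈ε⇒x≈y)
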